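{- For every $z\in U$ there exists a sequence $(b_n)_{n\ge 1}$ with $b_n\in\mathcal J$ for all $n\ge 1$ such that, defining $p_{ -1}=1,\ p_0=0,\ q_{ -1}=0,\ q_0=1$ and $$p_{n+1}=b_{n+1}p_n+p_{n-1},\qquad q_{n+1}=b_{n+1}q_n+q_{n-1}\qquad (n\ge 0),$$ one has $$z=\lim_{n\to\infty}\frac{p_n}{q_n}.$$
   Context: Let $\zeta=\frac{1+\sqrt{ -3}}2$, $\mathfrak o(\sqrt{ -3})=\mathbb Z+\mathbb Z\zeta$ (the ring of integers of $\mathbb Q(\sqrt{ -3})$), $\eta=\frac{3+\sqrt{ -3}}2$, and $\mathcal J=\eta\cdot\mathfrak o(\sqrt{ -3})=\{\eta a: a\in\mathfrak o(\sqrt{ -3})\}$. $U$ is the fundamental domain of $\mathbb C/\mathcal J$ consisting of the open regular hexagon with vertices $\zeta^k$, $0\le k\le 5$ (i.e. $\pm1,\pm\zeta,\pm\overline\zeta$), together with the three open sides $\{t\zeta+(1-t)(-\overline\zeta):0<t<1\}$, $\{t(-\zeta)+(1-t)(-1):0<t<1\}$, $\{t+(1-t)\overline\zeta:0<t<1\}$ and the two vertices $-\zeta$ and $\overline\zeta$. -}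

module Defs where

open import Algebra.Bundles using (CommutativeRing)
open import Algebra.Core using (Op₁; Op₂)
import Algebra.Properties.CommutativeMonoid.Sum as Sum
import Algebra.Properties.Monoid.Mult as Mult
import Algebra.Properties.Semiring.Exp as Exp
import Algebra.Properties.Ring as RingProperties
import Algebra.Solver.Ring.NaturalCoefficients.Default as Solver
open import Algebra.Structures using (IsCommutativeRing)
open import Data.Fin.Base using (Fin; toℕ)
open import Data.Integer.Base using (ℤ; +_; -[1+_])
open import Data.Nat.Base as ℕ using (ℕ; zero; suc)
open import Data.Product.Base using (Σ-syntax; ∃-syntax; _×_; _,_; proj₁; proj₂)
open import Data.Sum.Base using (_⊎_)
open import Level using (0ℓ) renaming (suc to lsuc)
open import Relation.Binary.Core using (Rel)
open import Relation.Binary.Structures using (IsStrictTotalOrder)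
open import Relation.Nullary.Negation using (¬_)
open import Relation.Unary using (Pred; _∈_)

-- Dedekind-complete ordered fields.  Classically there is exactly one up to
-- isomorphism, the field of real numbers.
record CompleteOrderedField : Set (lsuc 0ℓ) where
  infix  8 -_ _⁻¹
  infixl 7 _*_
  infixl 6 _+_
  infix  4 _≈_ _<_ _≤_
  field
    Carrier            : Set
    _≈_ _<_            : Rel Carrier 0ℓ
    _+_ _*_            : Op₂ Carrier
    -_ _⁻¹             : Op₁ Carrier
    0# 1#              : Carrier
    isCommutativeRing  : IsCommutativeRing _≈_ _+_ _*_ -_ 0# 1#
    isStrictTotalOrder : IsStrictTotalOrder _≈_ _<_
    0<1                : 0# < 1#
    +-monoʳ-<          : ∀ x {y z} → y < z → x + y < x + z
    *-pos              : ∀ {x y} → 0# < x → 0# < y → 0# < x * y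
    -- The inverse is a total function; nothing is said about the value 0# ⁻¹.
    ⁻¹-cong            : ∀ {x y} → x ≈ y → x ⁻¹ ≈ y ⁻¹
    ⁻¹-inverseʳ        : ∀ {x} → ¬ x ≈ 0# → x * x ⁻¹ ≈ 1#

  _≤_ : Rel Carrier 0ℓ
  x ≤ y = x < y ⊎ x ≈ y

  UpperBound : Pred Carrier 0ℓ → Pred Carrier 0ℓ
  UpperBound S u = ∀ x → x ∈ S → x ≤ u

  field
    supremum : (S : Pred Carrier 0ℓ) → ∃[ x ] x ∈ S → ∃[ u ] u ∈ UpperBound S →
               ∃[ s ] s ∈ UpperBound S × (∀ u → u ∈ UpperBound S → s ≤ u)

  commutativeRing : CommutativeRing 0ℓ 0ℓ
  commutativeRing = record { isCommutativeRing = isCommutativeRing }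

module Complex (R : CompleteOrderedField) where

  open CompleteOrderedField R public using () renaming
    ( Carrier to ℝ; _≈_ to _≈ʳ_; _<_ to _<ʳ_; _≤_ to _≤ʳ_
    ; _+_ to _+ʳ_; _*_ to _*ʳ_; -_ to -ʳ_; _⁻¹ to _⁻¹ʳ; 0# to 0ʳ; 1# to 1ʳ )
  private module ℝ = CommutativeRing (CompleteOrderedField.commutativeRing R)

  record ℂ : Set where
    constructor _+i_
    field
      re im : ℝ
  open ℂ public

  infix  8 -ᶜ_
  infixl 7 _*ᶜ_
  infixl 6 _+ᶜ_
  infix  4 _≈ᶜ_

  _≈ᶜ_ : Rel ℂ 0ℓ
  z ≈ᶜ w = re z ≈ʳ re w × im z ≈ʳ im w

  _+ᶜ_ _*ᶜ_ : Op₂ ℂ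
  z +ᶜ w = (re z +ʳ re w) +i (im z +ʳ im w)
  z *ᶜ w = (re z *ʳ re w +ʳ -ʳ (im z *ʳ im w)) +i (re z *ʳ im w +ʳ im z *ʳ re w)

  -ᶜ_ : Op₁ ℂ
  -ᶜ z = (-ʳ re z) +i (-ʳ im z)

  fromℝ : ℝ → ℂ
  fromℝ x = x +i 0ʳ

  private
    open RingProperties ℝ.ring using (-1*x≈-x; -0#≈0#)
    open Solver ℝ.commutativeSemiring

    -- x - y is handed to the semiring solver as x + m * y with m = - 1.
    m : ℝ
    m = -ʳ 1ʳ

    minus : ∀ x y → x +ʳ -ʳ y ≈ʳ x +ʳ m *ʳ y
    minus x y = ℝ.+-congˡ (ℝ.sym (-1*x≈-x y))

    minus* : ∀ x y z → (x +ʳ -ʳ y) *ʳ z ≈ʳ (x +ʳ m *ʳ y) *ʳ z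
    minus* x y z = ℝ.*-congʳ (minus x y)

    *minus : ∀ z x y → z *ʳ (x +ʳ -ʳ y) ≈ʳ z *ʳ (x +ʳ m *ʳ y)
    *minus z x y = ℝ.*-congˡ (minus x y)

    via : ∀ {x x′ y y′} → x ≈ʳ x′ → y ≈ʳ y′ → x′ ≈ʳ y′ → x ≈ʳ y
    via p q r = ℝ.trans p (ℝ.trans r (ℝ.sym q))

    *ᶜ-comm : ∀ z w → z *ᶜ w ≈ᶜ w *ᶜ z
    *ᶜ-comm (a +i b) (c +i d) =
      ℝ.+-cong (ℝ.*-comm a c) (ℝ.-‿cong (ℝ.*-comm b d)) ,
      solve 4 (λ a b c d → a :* d :+ b :* c := c :* b :+ d :* a) ℝ.refl a b c d

    *ᶜ-assoc : ∀ z w v → (z *ᶜ w) *ᶜ v ≈ᶜ z *ᶜ (w *ᶜ v)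
    *ᶜ-assoc (a +i b) (c +i d) (e +i f) =
      via (ℝ.trans (minus _ _) (ℝ.+-congʳ (minus* _ _ _)))
          (ℝ.trans (minus _ _) (ℝ.+-congʳ (*minus _ _ _)))
          (solve 7 (λ m a b c d e f →
             (a :* c :+ m :* (b :* d)) :* e :+ m :* ((a :* d :+ b :* c) :* f) :=
             a :* (c :* e :+ m :* (d :* f)) :+ m :* (b :* (c :* f :+ d :* e)))
             ℝ.refl m a b c d e f) ,
      via (ℝ.+-congʳ (minus* _ _ _)) (ℝ.+-congˡ (*minus _ _ _))
          (solve 7 (λ m a b c d e f →
             (a :* c :+ m :* (b :* d)) :* f :+ (a :* d :+ b :* c) :* e :=
             a :* (c :* f :+ d :* e) :+ b :* (c :* e :+ m :* (d :* f)))
             ℝ.refl m a b c d e f)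

    *ᶜ-distribʳ : ∀ v z w → (z +ᶜ w) *ᶜ v ≈ᶜ z *ᶜ v +ᶜ w *ᶜ v
    *ᶜ-distribʳ (e +i f) (a +i b) (c +i d) =
      via (minus _ _) (ℝ.+-cong (minus _ _) (minus _ _))
          (solve 7 (λ m a b c d e f →
             (a :+ c) :* e :+ m :* ((b :+ d) :* f) :=
             (a :* e :+ m :* (b :* f)) :+ (c :* e :+ m :* (d :* f)))
             ℝ.refl m a b c d e f) ,
      solve 6 (λ a b c d e f →
        (a :+ c) :* f :+ (b :+ d) :* e := (a :* f :+ b :* e) :+ (c :* f :+ d :* e))
        ℝ.refl a b c d e f

    *ᶜ-identityˡ : ∀ z → fromℝ 1ʳ *ᶜ z ≈ᶜ z
    *ᶜ-identityˡ (a +i b) =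
      ℝ.trans (ℝ.+-cong (ℝ.*-identityˡ a) (ℝ.trans (ℝ.-‿cong (ℝ.zeroˡ b)) -0#≈0#))
              (ℝ.+-identityʳ a) ,
      ℝ.trans (ℝ.+-cong (ℝ.*-identityˡ b) (ℝ.zeroˡ a)) (ℝ.+-identityʳ b)

    *ᶜ-cong : ∀ {z z′ w w′} → z ≈ᶜ z′ → w ≈ᶜ w′ → z *ᶜ w ≈ᶜ z′ *ᶜ w′
    *ᶜ-cong (a , b) (c , d) =
      ℝ.+-cong (ℝ.*-cong a c) (ℝ.-‿cong (ℝ.*-cong b d)) ,
      ℝ.+-cong (ℝ.*-cong a d) (ℝ.*-cong b c)

    ≈ᶜ-trans : ∀ {z w v} → z ≈ᶜ w → w ≈ᶜ v → z ≈ᶜ v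
    ≈ᶜ-trans (a , b) (c , d) = ℝ.trans a c , ℝ.trans b d

    *ᶜ-distribˡ : ∀ v z w → v *ᶜ (z +ᶜ w) ≈ᶜ v *ᶜ z +ᶜ v *ᶜ w
    *ᶜ-distribˡ v z w = ≈ᶜ-trans (*ᶜ-comm v (z +ᶜ w)) (≈ᶜ-trans (*ᶜ-distribʳ v z w)
      ( ℝ.+-cong (proj₁ (*ᶜ-comm z v)) (proj₁ (*ᶜ-comm w v))
      , ℝ.+-cong (proj₂ (*ᶜ-comm z v)) (proj₂ (*ᶜ-comm w v)) ))

  ℂ-commutativeRing : CommutativeRing 0ℓ 0ℓ
  ℂ-commutativeRing = record
    { Carrier = ℂ ; _≈_ = _≈ᶜ_ ; _+_ = _+ᶜ_ ; _*_ = _*ᶜ_ ; -_ = -ᶜ_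
    ; 0# = fromℝ 0ʳ ; 1# = fromℝ 1ʳ
    ; isCommutativeRing = record
      { isRing = record
        { +-isAbelianGroup = record
          { isGroup = record
            { isMonoid = record
              { isSemigroup = record
                { isMagma = record
                  { isEquivalence = record
                    { refl  = ℝ.refl , ℝ.refl
                    ; sym   = λ (a , b) → ℝ.sym a , ℝ.sym b
                    ; trans = ≈ᶜ-trans
                    }
                  ; ∙-cong = λ (a , b) (c , d) → ℝ.+-cong a c , ℝ.+-cong b d
                  }
                ; assoc = λ z w v → ℝ.+-assoc _ _ _ , ℝ.+-assoc _ _ _
                }
              ; identity = (λ z → ℝ.+-identityˡ _ , ℝ.+-identityˡ _)
                         , (λ z → ℝ.+-identityʳ _ , ℝ.+-identityʳ _)
              }
            ; inverse = (λ z → ℝ.-‿inverseˡ _ , ℝ.-‿inverseˡ _)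
                      , (λ z → ℝ.-‿inverseʳ _ , ℝ.-‿inverseʳ _)
            ; ⁻¹-cong = λ (a , b) → ℝ.-‿cong a , ℝ.-‿cong b
            }
          ; comm = λ z w → ℝ.+-comm _ _ , ℝ.+-comm _ _
          }
        ; *-cong = *ᶜ-cong
        ; *-assoc = *ᶜ-assoc
        ; *-identity = *ᶜ-identityˡ
                     , λ z → ≈ᶜ-trans (*ᶜ-comm z (fromℝ 1ʳ)) (*ᶜ-identityˡ z)
        ; distrib = *ᶜ-distribˡ , *ᶜ-distribʳ
        }
      ; *-comm = *ᶜ-comm
      }
    }

  open CommutativeRing ℂ-commutativeRing public
    using (_≈_; _≉_; _+_; _*_; -_; _-_; 0#; 1#)
  private module ℂ-ring = CommutativeRing ℂ-commutativeRing
  open Exp ℂ-ring.semiring public using (_^_)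
  open Mult ℂ-ring.+-monoid public using () renaming (_×_ to _×ᶜ_)
  open Sum ℂ-ring.+-commutativeMonoid public using () renaming (sum to sumᶜ)
  open Sum ℝ.+-commutativeMonoid public using () renaming (sum to sumʳ)

  conj : ℂ → ℂ
  conj z = re z +i (-ʳ im z)

  ∣_∣² : ℂ → ℝ
  ∣ z ∣² = re z *ʳ re z +ʳ im z *ʳ im z

  infix  8 _⁻¹
  infixl 7 _/_

  -- Meaningful only for nonzero arguments.
  _⁻¹ : Op₁ ℂ
  z ⁻¹ = fromℝ (∣ z ∣² ⁻¹ʳ) * conj z

  _/_ : Op₂ ℂ
  z / w = z * w ⁻¹

  -- ∣ z - w ∣ < ε, for positive ε
  Within : ℝ → ℂ → ℂ → Set
  Within ε z w = ∣ z - w ∣² <ʳ ε *ʳ ε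

  infix 4 _⟶_
  _⟶_ : (ℕ → ℂ) → ℂ → Set
  x ⟶ z = ∀ ε → 0ʳ <ʳ ε → ∃[ N ] (∀ n → N ℕ.≤ n → Within ε (x n) z)

  Interior : Pred ℂ 0ℓ → Pred ℂ 0ℓ
  Interior S z = ∃[ ε ] 0ʳ <ʳ ε × (∀ w → Within ε w z → w ∈ S)

  ConvexHull : ∀ {k} → (Fin k → ℂ) → Pred ℂ 0ℓ
  ConvexHull {k} v z =
    Σ[ t ∈ (Fin k → ℝ) ] (∀ i → 0ʳ ≤ʳ t i) × sumʳ t ≈ʳ 1ʳ × z ≈ sumᶜ (λ i → fromℝ (t i) * v i)

  OpenSegment : ℂ → ℂ → Pred ℂ 0ℓ
  OpenSegment a b z =
    ∃[ t ] 0ʳ <ʳ t × t <ʳ 1ʳ × z ≈ fromℝ t * a + (1# - fromℝ t) * b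

  fromℤ : ℤ → ℂ
  fromℤ (+ n)    = n ×ᶜ 1#
  fromℤ -[1+ n ] = - (suc n ×ᶜ 1#)

  -- Solution of x (n + 1) = b (n + 1) x n + x (n - 1), n ≥ 0, with the given
  -- values at - 1 and 0.  The entry b 0 is never used.
  recurrence : (x₋₁ x₀ : ℂ) (b : ℕ → ℂ) → ℕ → ℂ
  recurrence x₋₁ x₀ b zero          = x₀
  recurrence x₋₁ x₀ b (suc zero)    = b 1 * x₀ + x₋₁
  recurrence x₋₁ x₀ b (suc (suc n)) =
    b (suc (suc n)) * recurrence x₋₁ x₀ b (suc n) + recurrence x₋₁ x₀ b n

  p q : (ℕ → ℂ) → ℕ → ℂ
  p = recurrence 1# 0#
  q = recurrence 0# 1#

  -- Intended for √3 the positive square root of 3.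
  module Eisenstein (√3 : ℝ) where

    √-3 2⁻¹ ζ η : ℂ
    √-3 = 0ʳ +i √3
    2⁻¹ = fromℤ (+ 2) ⁻¹
    ζ   = (fromℤ (+ 1) + √-3) * 2⁻¹
    η   = (fromℤ (+ 3) + √-3) * 2⁻¹

    𝔬 : Pred ℂ 0ℓ
    𝔬 z = ∃[ m ] ∃[ n ] z ≈ fromℤ m + fromℤ n * ζ

    𝒥 : Pred ℂ 0ℓ
    𝒥 z = ∃[ a ] a ∈ 𝔬 × z ≈ η * a

    OpenHexagon : Pred ℂ 0ℓ
    OpenHexagon = Interior (ConvexHull {6} (λ k → ζ ^ toℕ k))

    data U (z : ℂ) : Set where
      interior : z ∈ OpenHexagon → z ∈ U
      side₁    : z ∈ OpenSegment ζ (- conj ζ) → z ∈ U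
      side₂    : z ∈ OpenSegment (- ζ) (- 1#) → z ∈ U
      side₃    : z ∈ OpenSegment 1# (conj ζ) → z ∈ U
      vertex₁  : z ≈ - ζ → z ∈ U
      vertex₂  : z ≈ conj ζ → z ∈ U

{-# OPTIONS --safe #-}

-- Put e n = q n * z - p n, with e (-1) = -1 and e 0 = z: it satisfies the recurrence of p and q,
-- and q (n + 1) * e n - e (n + 1) * q n is a sign.  If e n ≠ 0, the quotient of - e (n - 1) by
-- η * e n lies in a triangle of side 1 of the lattice 𝔬.  A digit η * g with g a vertex of that
-- triangle gives ∣e (n + 1)∣ < ∣e n∣, unless the quotient is the centre of the triangle; then all
-- three vertices give ∣e (n + 1)∣ = ∣e n∣, the three values of e (n + 1) sum to zero, and one of
-- them gives ∣q (n + 1)∣ > ∣q n∣.  If e n = 0, a digit ± η gives e (n + 1) = e (n - 1) and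
-- ∣q (n + 1)∣ > ∣q (n - 1)∣.  So (- ∣e n∣, ∣q n∣) increases lexicographically along the n with
-- e n ≠ 0, and there the pairs (p n , q n) are distinct.  They have ∣e n∣ ≤ 1 and entries in the
-- discrete set 𝔬, hence ∣q n∣ → ∞, and ∣p n / q n - z∣ = ∣e n∣ / ∣q n∣ → 0.  Of U only the
-- inclusion in the closed unit disc matters.
module Submission where

open import Algebra.Bundles using (CommutativeRing)
import Algebra.Properties.AbelianGroup as AbelianGroupProperties
import Algebra.Properties.Ring as RingProperties
import Algebra.Properties.Semiring.Mult as Mult
import Algebra.Properties.Semiring.Mult.TCOptimised as Mult′
import Algebra.Solver.Ring as RingSolver
open import Algebra.Solver.Ring.AlmostCommutativeRing
  using (fromCommutativeRing; _-Raw-AlmostCommutative⟶_)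
open import Axiom.ExcludedMiddle using (ExcludedMiddle)
open import Data.Empty using (⊥; ⊥-elim)
open import Data.Fin.Base using (Fin; zero; suc; toℕ)
open import Data.Integer.Base as ℤ using (ℤ; +_; -[1+_]; _⊖_)
import Data.Integer.Properties as ℤ
open import Data.Maybe.Base using (Maybe; just; nothing)
open import Data.Nat.Base as ℕ using (ℕ; zero; suc; z≤n; s≤s)
import Data.Nat.Properties as Nat
open import Data.Product.Base using (Σ-syntax; ∃-syntax; _×_; _,_; proj₁; proj₂)
open import Data.Sum.Base using (_⊎_; inj₁; inj₂)
open import Level using (0ℓ)
open import Relation.Binary.Definitions using (tri<; tri≈; tri>)
import Relation.Binary.Construct.StrictToNonStrict as StrictToNonStrict
open import Relation.Binary.PropositionalEquality.Core as ≡ using (_≡_)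
import Relation.Binary.Reasoning.Setoid as SetoidReasoning
open import Relation.Binary.Structures using (IsStrictTotalOrder)
open import Relation.Nullary using (¬_; yes; no)
open import Relation.Unary using (_∈_)
open import Defs

-- Integer coefficients for the ring solver

module IntegerCoefficients (R : CommutativeRing 0ℓ 0ℓ) where

  open CommutativeRing R
  open RingProperties ring
    using (-‿distribˡ-*; -‿distribʳ-*; -‿involutive; -0#≈0#)
  open AbelianGroupProperties +-abelianGroup using (⁻¹-∙-comm)
  open Mult semiring using () renaming (_×_ to _×ᵤ_)
  open Mult′ semiring using (×-homo-+; ×1-homo-*; ×ᵤ≈×; 1+×) renaming (_×_ to _×′_)
  open import Relation.Binary.Reasoning.Setoid setoid

  -- Optimised multiples let `ι (+ 1)` compute to `1#` and `ι (+ 3)` to `1# + 1# + 1#`, so that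
  -- `con` matches numerals spelled out as sums.
  ι : ℤ → Carrier
  ι (+ n)    = n ×′ 1#
  ι -[1+ n ] = - (suc n ×′ 1#)

  ι-unoptimised : ∀ n → n ×ᵤ 1# ≈ n ×′ 1#
  ι-unoptimised n = ×ᵤ≈× n 1#

  ι-neg : ∀ i → ι (ℤ.- i) ≈ - ι i
  ι-neg (+ zero)  = sym -0#≈0#
  ι-neg (+ suc n) = refl
  ι-neg -[1+ n ]  = sym (-‿involutive _)

  ι-⊖ : ∀ m n → ι (m ⊖ n) ≈ m ×′ 1# - n ×′ 1#
  ι-⊖ m zero = begin
    ι (m ⊖ 0)        ≡⟨ ≡.cong ι (ℤ.⊖-≥ {m} z≤n) ⟩
    m ×′ 1#           ≈⟨ +-identityʳ _ ⟨
    m ×′ 1# + 0#      ≈⟨ +-congˡ -0#≈0# ⟨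
    m ×′ 1# - 0#      ∎
  ι-⊖ zero (suc n) = sym (+-identityˡ _)
  ι-⊖ (suc m) (suc n) = begin
    ι (suc m ⊖ suc n)                  ≡⟨ ≡.cong ι (ℤ.[1+m]⊖[1+n]≡m⊖n m n) ⟩
    ι (m ⊖ n)                          ≈⟨ ι-⊖ m n ⟩
    m ×′ 1# - n ×′ 1#                    ≈⟨ +-congʳ (+-identityˡ _) ⟨
    0# + m ×′ 1# - n ×′ 1#               ≈⟨ +-congʳ (+-congʳ (-‿inverseʳ 1#)) ⟨
    1# - 1# + m ×′ 1# - n ×′ 1#          ≈⟨ +-congʳ (+-assoc _ _ _) ⟩
    1# + (- 1# + m ×′ 1#) - n ×′ 1#      ≈⟨ +-congʳ (+-congˡ (+-comm _ _)) ⟩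
    1# + (m ×′ 1# - 1#) - n ×′ 1#        ≈⟨ +-congʳ (+-assoc _ _ _) ⟨
    1# + m ×′ 1# - 1# - n ×′ 1#          ≈⟨ +-assoc _ _ _ ⟩
    1# + m ×′ 1# + (- 1# - n ×′ 1#)      ≈⟨ +-congˡ (⁻¹-∙-comm _ _) ⟩
    1# + m ×′ 1# - (1# + n ×′ 1#)        ≈⟨ +-cong (1+× m 1#) (-‿cong (1+× n 1#)) ⟨
    suc m ×′ 1# - suc n ×′ 1#            ∎

  ι-+ : ∀ i j → ι (i ℤ.+ j) ≈ ι i + ι j
  ι-+ (+ m)    (+ n)    = ×-homo-+ 1# m n
  ι-+ (+ m)    -[1+ n ] = ι-⊖ m (suc n)
  ι-+ -[1+ m ] (+ n)    = trans (ι-⊖ n (suc m)) (+-comm _ _)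
  ι-+ -[1+ m ] -[1+ n ] = begin
    - (suc (suc (m ℕ.+ n)) ×′ 1#)       ≡⟨ ≡.cong (λ k → - (k ×′ 1#)) (≡.sym (Nat.+-suc (suc m) n)) ⟩
    - ((suc m ℕ.+ suc n) ×′ 1#)         ≈⟨ -‿cong (×-homo-+ 1# (suc m) (suc n)) ⟩
    - (suc m ×′ 1# + suc n ×′ 1#)        ≈⟨ ⁻¹-∙-comm _ _ ⟨
    - (suc m ×′ 1#) - suc n ×′ 1#        ∎

  ι-*ᵖ : ∀ m j → ι (+ m ℤ.* j) ≈ m ×′ 1# * ι j
  ι-*ᵖ m (+ n) = begin
    ι (+ m ℤ.* + n)              ≡⟨ ≡.cong ι (ℤ.pos-* m n) ⟨
    (m ℕ.* n) ×′ 1#               ≈⟨ ×1-homo-* m n ⟩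
    m ×′ 1# * n ×′ 1#              ∎
  ι-*ᵖ m -[1+ n ] = begin
    ι (+ m ℤ.* -[1+ n ])         ≡⟨ ≡.cong ι (ℤ.neg-distribʳ-* (+ m) (+ suc n)) ⟨
    ι (ℤ.- (+ m ℤ.* + suc n))    ≈⟨ ι-neg (+ m ℤ.* + suc n) ⟩
    - ι (+ m ℤ.* + suc n)        ≈⟨ -‿cong (ι-*ᵖ m (+ suc n)) ⟩
    - (m ×′ 1# * suc n ×′ 1#)      ≈⟨ -‿distribʳ-* _ _ ⟩
    m ×′ 1# * - (suc n ×′ 1#)      ∎

  ι-* : ∀ i j → ι (i ℤ.* j) ≈ ι i * ι j
  ι-* (+ m)    j = ι-*ᵖ m j
  ι-* -[1+ m ] j = begin
    ι (-[1+ m ] ℤ.* j)           ≡⟨ ≡.cong ι (ℤ.neg-distribˡ-* (+ suc m) j) ⟨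
    ι (ℤ.- (+ suc m ℤ.* j))      ≈⟨ ι-neg (+ suc m ℤ.* j) ⟩
    - ι (+ suc m ℤ.* j)          ≈⟨ -‿cong (ι-*ᵖ (suc m) j) ⟩
    - (suc m ×′ 1# * ι j)         ≈⟨ -‿distribˡ-* _ _ ⟩
    - (suc m ×′ 1#) * ι j         ∎

  private
    homomorphism : ℤ.+-*-rawRing -Raw-AlmostCommutative⟶ fromCommutativeRing R
    homomorphism = record
      { ⟦_⟧ = ι ; +-homo = ι-+ ; *-homo = ι-* ; -‿homo = ι-neg ; 0-homo = refl ; 1-homo = refl }

    dec : ∀ i j → Maybe (ι i ≈ ι j)
    dec i j with i ℤ.≟ j
    ... | yes ≡.refl = just refl
    ... | no _       = nothing

  open RingSolver ℤ.+-*-rawRing (fromCommutativeRing R) homomorphism dec public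
    using (Polynomial; solve; con; _:+_; _:*_; _:-_; :-_; _:=_)

  -- Serves to turn equations that depend on hypotheses into pure ring identities: once the
  -- multiplier `c` is supplied by hand, the solver can check the rest.
  linear-combination : ∀ {a b x y} c → a ≈ b → x - y ≈ c * (a - b) → x ≈ y
  linear-combination {a} {b} {x} {y} c a≈b x-y≈ = begin
    x              ≈⟨ solve 2 (λ x y → x := x :- y :+ y) refl x y ⟩
    x - y + y      ≈⟨ +-congʳ x-y≈ ⟩
    c * (a - b) + y ≈⟨ +-congʳ (*-congˡ (+-congʳ a≈b)) ⟩
    c * (b - b) + y ≈⟨ solve 3 (λ b c y → c :* (b :- b) :+ y := y) refl b c y ⟩
    y              ∎

  linear-combination₂ : ∀ {a b a′ b′ x y} c c′ → a ≈ b → a′ ≈ b′ →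
                        x - y ≈ c * (a - b) + c′ * (a′ - b′) → x ≈ y
  linear-combination₂ {a} {b} {a′} {b′} {x} {y} c c′ a≈b a′≈b′ x-y≈ =
    linear-combination c a≈b (begin
      x - y                              ≈⟨ x-y≈ ⟩
      c * (a - b) + c′ * (a′ - b′)       ≈⟨ +-congˡ (*-congˡ (+-congʳ a′≈b′)) ⟩
      c * (a - b) + c′ * (b′ - b′)       ≈⟨ solve 3 (λ e c′ b′ → e :+ c′ :* (b′ :- b′) := e) refl _ c′ b′ ⟩
      c * (a - b)                        ∎)

-- Ordered fields

module OrderedField (F : CompleteOrderedField) where

  open CompleteOrderedField F
    using (_<_; _≤_; _⁻¹; 0<1; +-monoʳ-<; *-pos; ⁻¹-inverseʳ; supremum; isStrictTotalOrder) public
  open CommutativeRing (CompleteOrderedField.commutativeRing F)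
    hiding (zero) public
  open IntegerCoefficients (CompleteOrderedField.commutativeRing F) public
  open IsStrictTotalOrder isStrictTotalOrder public
    using (compare; irrefl; <-resp-≈; <-respˡ-≈; <-respʳ-≈) renaming (trans to <-trans)
  private module S = StrictToNonStrict _≈_ _<_

  <-≤-trans : ∀ {x y z} → x < y → y ≤ z → x < z
  <-≤-trans = S.<-≤-trans <-trans (<-resp-≈ .proj₁)

  ≤-<-trans : ∀ {x y z} → x ≤ y → y < z → x < z
  ≤-<-trans = S.≤-<-trans sym <-trans (<-resp-≈ .proj₂)

  ≤-trans : ∀ {x y z} → x ≤ y → y ≤ z → x ≤ z
  ≤-trans = S.trans isEquivalence <-resp-≈ <-trans

  <⇒≱ : ∀ {x y} → x < y → ¬ y ≤ x
  <⇒≱ p q = irrefl refl (<-≤-trans p q)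

  ≮⇒≥ : ∀ {x y} → ¬ x < y → y ≤ x
  ≮⇒≥ {x} {y} x≮y with compare x y
  ... | tri< x<y _ _ = ⊥-elim (x≮y x<y)
  ... | tri≈ _ x≈y _ = inj₂ (sym x≈y)
  ... | tri> _ _ y<x = inj₁ y<x

  <-or-≥ : ∀ x y → x < y ⊎ y ≤ x
  <-or-≥ x y with compare x y
  ... | tri< x<y _ _ = inj₁ x<y
  ... | tri≈ _ x≈y _ = inj₂ (inj₂ (sym x≈y))
  ... | tri> _ _ y<x = inj₂ (inj₁ y<x)

  ≤-respʳ-≈ : ∀ {x y z} → y ≈ z → x ≤ y → x ≤ z
  ≤-respʳ-≈ y≈z x≤y = ≤-trans x≤y (inj₂ y≈z)

  0<⇒< : ∀ {x y d} → 0# < d → y ≈ x + d → x < y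
  0<⇒< {x} 0<d y≈x+d =
    <-respʳ-≈ (sym y≈x+d) (<-respˡ-≈ (+-identityʳ x) (+-monoʳ-< x 0<d))

  0≤⇒≤ : ∀ {x y d} → 0# ≤ d → y ≈ x + d → x ≤ y
  0≤⇒≤ (inj₁ 0<d) y≈ = inj₁ (0<⇒< 0<d y≈)
  0≤⇒≤ (inj₂ 0≈d) y≈ = inj₂ (sym (trans y≈ (trans (+-congˡ (sym 0≈d)) (+-identityʳ _))))

  <⇒0< : ∀ {x y} → x < y → 0# < y - x
  <⇒0< {x} {y} x<y = <-respʳ-≈ (+-comm (- x) y) (<-respˡ-≈ (-‿inverseˡ x) (+-monoʳ-< (- x) x<y))

  ≤⇒0≤ : ∀ {x y} → x ≤ y → 0# ≤ y - x
  ≤⇒0≤ (inj₁ x<y) = inj₁ (<⇒0< x<y)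
  ≤⇒0≤ {x} (inj₂ x≈y) = inj₂ (trans (sym (-‿inverseʳ x)) (+-congʳ x≈y))

  infixl 6 _0<+_ _0≤+_
  infixl 7 _0≤*_

  _0<+_ : ∀ {x y} → 0# < x → 0# ≤ y → 0# < x + y
  _0<+_ {x} 0<x 0≤y = <-≤-trans 0<x (0≤⇒≤ 0≤y refl)

  _0≤+_ : ∀ {x y} → 0# ≤ x → 0# ≤ y → 0# ≤ x + y
  _0≤+_ {x} 0≤x 0≤y = ≤-trans 0≤x (0≤⇒≤ 0≤y refl)

  _0≤*_ : ∀ {x y} → 0# ≤ x → 0# ≤ y → 0# ≤ x * y
  inj₁ 0<x 0≤* inj₁ 0<y = inj₁ (*-pos 0<x 0<y)
  inj₁ 0<x 0≤* inj₂ 0≈y = inj₂ (trans (sym (zeroʳ _)) (*-congˡ 0≈y))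
  inj₂ 0≈x 0≤* _        = inj₂ (trans (sym (zeroˡ _)) (*-congʳ 0≈x))

  0<-neg : ∀ {x} → x < 0# → 0# < - x
  0<-neg {x} x<0 = <-respʳ-≈ (+-identityˡ (- x)) (<⇒0< x<0)

  0<x² : ∀ {x} → ¬ x ≈ 0# → 0# < x * x
  0<x² {x} x≉0 with compare 0# x
  ... | tri< 0<x _ _ = *-pos 0<x 0<x
  ... | tri≈ _ 0≈x _ = ⊥-elim (x≉0 (sym 0≈x))
  ... | tri> _ _ x<0 = <-respʳ-≈ (solve 1 (λ x → :- x :* :- x := x :* x) refl x)
                                 (*-pos (0<-neg x<0) (0<-neg x<0))

  0≤x² : ∀ x → 0# ≤ x * x
  0≤x² x with compare x 0#
  ... | tri< _ x≉0 _ = inj₁ (0<x² x≉0)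
  ... | tri≈ _ x≈0 _ = inj₂ (sym (trans (*-congʳ x≈0) (zeroˡ x)))
  ... | tri> _ x≉0 _ = inj₁ (0<x² x≉0)

  0≤1 : 0# ≤ 1#
  0≤1 = inj₁ 0<1

  *-monoʳ-≤ : ∀ {c x y} → 0# ≤ c → x ≤ y → c * x ≤ c * y
  *-monoʳ-≤ {c} {x} {y} 0≤c x≤y = 0≤⇒≤ (0≤c 0≤* ≤⇒0≤ x≤y)
    (solve 3 (λ c x y → c :* y := c :* x :+ c :* (y :- x)) refl c x y)

  *-monoʳ-< : ∀ {c x y} → 0# < c → x < y → c * x < c * y
  *-monoʳ-< {c} {x} {y} 0<c x<y = 0<⇒< (*-pos 0<c (<⇒0< x<y))
    (solve 3 (λ c x y → c :* y := c :* x :+ c :* (y :- x)) refl c x y)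

  *-cancelˡ-< : ∀ {c x y} → 0# ≤ c → c * x < c * y → x < y
  *-cancelˡ-< {c} {x} {y} 0≤c cx<cy with <-or-≥ x y
  ... | inj₁ x<y = x<y
  ... | inj₂ y≤x = ⊥-elim (<⇒≱ cx<cy (*-monoʳ-≤ 0≤c y≤x))

  +-mono-≤ : ∀ {x y u v} → x ≤ y → u ≤ v → x + u ≤ y + v
  +-mono-≤ {x} {y} {u} {v} x≤y u≤v = 0≤⇒≤ (≤⇒0≤ x≤y 0≤+ ≤⇒0≤ u≤v)
    (solve 4 (λ x y u v → y :+ v := x :+ u :+ (y :- x :+ (v :- u))) refl x y u v)

  0<⇒≉0 : ∀ {x} → 0# < x → ¬ x ≈ 0#
  0<⇒≉0 0<x x≈0 = irrefl (sym x≈0) 0<x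

  0<2 : 0# < 1# + 1#
  0<2 = 0<1 0<+ 0≤1

  ι-suc : ∀ n → ι (+ suc n) ≈ 1# + ι (+ n)
  ι-suc n = Mult′.1+× semiring n 1#

  0≤ι : ∀ n → 0# ≤ ι (+ n)
  0≤ι zero    = inj₂ refl
  0≤ι (suc n) = ≤-respʳ-≈ (sym (ι-suc n)) (0≤1 0≤+ 0≤ι n)

  1≤ι-suc : ∀ n → 1# ≤ ι (+ suc n)
  1≤ι-suc n = 0≤⇒≤ (0≤ι n) (ι-suc n)

  ι-mono-≤ : ∀ {m n} → m ℕ.≤ n → ι (+ m) ≤ ι (+ n)
  ι-mono-≤ {n = n} z≤n = 0≤ι n
  ι-mono-≤ (s≤s {m} {n} m≤n) =
    ≤-trans (inj₂ (ι-suc m)) (≤-respʳ-≈ (sym (ι-suc n)) (+-mono-≤ (inj₂ refl) (ι-mono-≤ m≤n)))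

  module _ (em : ExcludedMiddle 0ℓ) where

    -- If no natural number exceeded `x`, the naturals would have a supremum `s`; as `n + 1` is
    -- below `s` for every `n`, the number `s - 1` would be a smaller upper bound.
    archimedean : ∀ x → ∃[ n ] x < ι (+ n)
    archimedean x with em {∃[ n ] x < ι (+ n)}
    ... | yes bounded  = bounded
    ... | no unbounded = ⊥-elim (<⇒≱ s-1<s (least (s - 1#) s-1-upper))
      where
      sup = supremum (λ y → ∃[ n ] y ≈ ι (+ n)) (0# , 0 , refl)
              (x , λ y (n , y≈n) → ≤-trans (inj₂ y≈n) (≮⇒≥ λ x<n → unbounded (n , x<n)))
      s     = proj₁ sup
      upper = proj₁ (proj₂ sup)
      least = proj₂ (proj₂ sup)

      s-1<s : s - 1# < s
      s-1<s = 0<⇒< 0<1 (solve 1 (λ s → s := s :- con (+ 1) :+ con (+ 1)) refl s)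

      s-1-upper : ∀ y → ∃[ n ] y ≈ ι (+ n) → y ≤ s - 1#
      s-1-upper y (n , y≈n) = 0≤⇒≤ (≤⇒0≤ (upper (ι (+ suc n)) (suc n , refl)))
        (linear-combination₂ (- 1#) 1# y≈n (ι-suc n)
          (solve 4 (λ s y n n′ → s :- con (+ 1) :- (y :+ (s :- n′))
             := :- con (+ 1) :* (y :- n) :+ con (+ 1) :* (n′ :- (con (+ 1) :+ n)))
             refl s y (ι (+ n)) (ι (+ suc n))))

    floor-below : ∀ n {x} → 0# ≤ x → x < ι (+ n) → ∃[ m ] ι (+ m) ≤ x × x < ι (+ suc m)
    floor-below zero    0≤x x<0 = ⊥-elim (<⇒≱ x<0 0≤x)
    floor-below (suc n) {x} 0≤x x<n′ with <-or-≥ x (ι (+ n))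
    ... | inj₁ x<n = floor-below n 0≤x x<n
    ... | inj₂ n≤x = n , n≤x , x<n′

    -- A natural `k` above `- x` makes `x + k` positive, and a natural above `x + k` starts the
    -- descent of `floor-below`; the integer part of `x` is then `m - k`.
    floor : ∀ x → ∃[ i ] 0# ≤ x - ι i × 0# ≤ 1# - (x - ι i)
    floor x with archimedean (- x)
    ... | k , -x<k with archimedean (x + ι (+ k))
    ... | n , x+k<n
      with floor-below n (inj₁ (<-respʳ-≈ (solve 2 (λ x k → k :- :- x := x :+ k) refl x (ι (+ k)))
                                         (<⇒0< -x<k))) x+k<n
    ... | m , m≤x+k , x+k<1+m = + m ℤ.- + k ,
      ≤-respʳ-≈ eq (≤⇒0≤ m≤x+k) ,
      inj₁ (<-respʳ-≈ (linear-combination₂ 1# (- 1#) (ι-suc m) (trans (ι-+ (+ m) (ℤ.- + k)) (+-congˡ (ι-neg (+ k))))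
        (solve 5 (λ x k m m′ i → m′ :- (x :+ k) :- (con (+ 1) :- (x :- i))
          := con (+ 1) :* (m′ :- (con (+ 1) :+ m)) :+ :- con (+ 1) :* (i :- (m :- k)))
          refl x (ι (+ k)) (ι (+ m)) (ι (+ suc m)) (ι (+ m ℤ.- + k)))) (<⇒0< x+k<1+m))
      where
      eq : x + ι (+ k) - ι (+ m) ≈ x - ι (+ m ℤ.- + k)
      eq = linear-combination 1# (trans (ι-+ (+ m) (ℤ.- + k)) (+-congˡ (ι-neg (+ k))))
        (solve 4 (λ x k m i → x :+ k :- m :- (x :- i) := con (+ 1) :* (i :- (m :- k)))
          refl x (ι (+ k)) (ι (+ m)) (ι (+ m ℤ.- + k)))

-- Squared norms, scalar products and inverses of complex numbers

module ComplexProperties (R : CompleteOrderedField) where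

  open Complex R
  module ℝ = OrderedField R
  module ℂ-ring = CommutativeRing ℂ-commutativeRing
  module ℂ-ι = IntegerCoefficients ℂ-commutativeRing

  inner : ℂ → ℂ → ℝ
  inner z w = re z *ʳ re w +ʳ im z *ʳ im w

  module _ where
    open ℝ using (solve; con; _:+_; _:*_; _:-_; :-_; _:=_)

    N-cong : ∀ {z w} → z ≈ w → ∣ z ∣² ≈ʳ ∣ w ∣²
    N-cong (a , b) = ℝ.+-cong (ℝ.*-cong a a) (ℝ.*-cong b b)

    N-* : ∀ z w → ∣ z * w ∣² ≈ʳ ∣ z ∣² *ʳ ∣ w ∣²
    N-* (a +i b) (c +i d) = solve 4 (λ a b c d →
      (a :* c :- b :* d) :* (a :* c :- b :* d) :+ (a :* d :+ b :* c) :* (a :* d :+ b :* c)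
        := (a :* a :+ b :* b) :* (c :* c :+ d :* d)) ℝ.refl a b c d

    N-neg : ∀ z → ∣ - z ∣² ≈ʳ ∣ z ∣²
    N-neg (a +i b) = solve 2 (λ a b → :- a :* :- a :+ :- b :* :- b := a :* a :+ b :* b) ℝ.refl a b

    N-+ : ∀ z w → ∣ z + w ∣² ≈ʳ ∣ z ∣² +ʳ ∣ w ∣² +ʳ (1ʳ +ʳ 1ʳ) *ʳ inner z w
    N-+ (a +i b) (c +i d) = solve 4 (λ a b c d →
      (a :+ c) :* (a :+ c) :+ (b :+ d) :* (b :+ d)
        := (a :* a :+ b :* b) :+ (c :* c :+ d :* d) :+ con (+ 2) :* (a :* c :+ b :* d))
      ℝ.refl a b c d

    -- The parallelogram law with the term `∣ z - w ∣²` dropped. It takes the place of the triangle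
    -- inequality, so that squared norms suffice.
    N-+≤ : ∀ z w → ∣ z + w ∣² ≤ʳ (1ʳ +ʳ 1ʳ) *ʳ (∣ z ∣² +ʳ ∣ w ∣²)
    N-+≤ (a +i b) (c +i d) = ℝ.0≤⇒≤ (ℝ.0≤x² (a +ʳ -ʳ c) ℝ.0≤+ ℝ.0≤x² (b +ʳ -ʳ d))
      (solve 4 (λ a b c d →
      con (+ 2) :* ((a :* a :+ b :* b) :+ (c :* c :+ d :* d)) :=
      (a :+ c) :* (a :+ c) :+ (b :+ d) :* (b :+ d) :+ ((a :- c) :* (a :- c) :+ (b :- d) :* (b :- d)))
      ℝ.refl a b c d)

    0≤N : ∀ z → 0ʳ ≤ʳ ∣ z ∣²
    0≤N z = ℝ.0≤x² (re z) ℝ.0≤+ ℝ.0≤x² (im z)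

    N-0 : ∣ 0# ∣² ≈ʳ 0ʳ
    N-0 = solve 0 (con (+ 0) :* con (+ 0) :+ con (+ 0) :* con (+ 0) := con (+ 0)) ℝ.refl

    N-1 : ∣ 1# ∣² ≈ʳ 1ʳ
    N-1 = solve 0 (con (+ 1) :* con (+ 1) :+ con (+ 0) :* con (+ 0) := con (+ 1)) ℝ.refl

    0<N : ∀ {z} → z ≉ 0# → 0ʳ <ʳ ∣ z ∣²
    0<N {z} z≉0 with ℝ.compare (re z) 0ʳ
    ... | tri< _ a≉0 _ = ℝ.0<x² a≉0 ℝ.0<+ ℝ.0≤x² (im z)
    ... | tri> _ a≉0 _ = ℝ.0<x² a≉0 ℝ.0<+ ℝ.0≤x² (im z)
    ... | tri≈ _ a≈0 _ =
      ℝ.<-respʳ-≈ (ℝ.+-comm _ _) (ℝ.0<x² (λ b≈0 → z≉0 (a≈0 , b≈0)) ℝ.0<+ ℝ.0≤x² (re z))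

    0<N⇒≉0 : ∀ {z} → 0ʳ <ʳ ∣ z ∣² → z ≉ 0#
    0<N⇒≉0 0<N z≈0 = ℝ.irrefl (ℝ.sym (ℝ.trans (N-cong z≈0) N-0)) 0<N

    ≈0-or-≉0 : ∀ z → z ≈ 0# ⊎ z ≉ 0#
    ≈0-or-≉0 z with ℝ.compare (re z) 0ʳ | ℝ.compare (im z) 0ʳ
    ... | tri≈ _ a≈0 _ | tri≈ _ b≈0 _ = inj₁ (a≈0 , b≈0)
    ... | tri< _ a≉0 _ | _            = inj₂ (λ z≈0 → a≉0 (proj₁ z≈0))
    ... | tri> _ a≉0 _ | _            = inj₂ (λ z≈0 → a≉0 (proj₁ z≈0))
    ... | tri≈ _ _ _   | tri< _ b≉0 _ = inj₂ (λ z≈0 → b≉0 (proj₂ z≈0))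
    ... | tri≈ _ _ _   | tri> _ b≉0 _ = inj₂ (λ z≈0 → b≉0 (proj₂ z≈0))

    ⁻¹-inverseʳ : ∀ {z} → z ≉ 0# → z * z ⁻¹ ≈ 1#
    ⁻¹-inverseʳ {a +i b} z≉0 =
      ℝ.linear-combination 1ʳ (ℝ.⁻¹-inverseʳ (ℝ.0<⇒≉0 (0<N z≉0)))
        (solve 3 (λ a b n →
           a :* (n :* a :- con (+ 0) :* :- b) :- b :* (n :* :- b :+ con (+ 0) :* a) :- con (+ 1)
           := con (+ 1) :* ((a :* a :+ b :* b) :* n :- con (+ 1)))
           ℝ.refl a b n) ,
      solve 3 (λ a b n →
        a :* (n :* :- b :+ con (+ 0) :* a) :+ b :* (n :* a :- con (+ 0) :* :- b) := con (+ 0))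
        ℝ.refl a b n
      where n = ∣ a +i b ∣² ⁻¹ʳ

    fromℝ-cong : ∀ {x y} → x ≈ʳ y → fromℝ x ≈ fromℝ y
    fromℝ-cong x≈y = x≈y , ℝ.refl

    fromℝ-+ : ∀ x y → fromℝ (x +ʳ y) ≈ fromℝ x + fromℝ y
    fromℝ-+ x y = ℝ.refl , ℝ.sym (ℝ.+-identityʳ 0ʳ)

    fromℝ-neg : ∀ x → fromℝ (-ʳ x) ≈ - fromℝ x
    fromℝ-neg x = ℝ.refl , solve 0 (con (+ 0) := :- con (+ 0)) ℝ.refl

  fromℤ≈ι : ∀ i → fromℤ i ≈ ℂ-ι.ι i
  fromℤ≈ι (+ n)    = ℂ-ι.ι-unoptimised n
  fromℤ≈ι -[1+ n ] = ℂ-ring.-‿cong (ℂ-ι.ι-unoptimised (suc n))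

  fromℝ-× : ∀ n → fromℝ (ℝ.ι (+ n)) ≈ fromℤ (+ n)
  fromℝ-× zero    = ℂ-ring.refl
  fromℝ-× (suc n) = ℂ-ring.trans (fromℝ-cong (ℝ.ι-suc n))
    (ℂ-ring.trans (fromℝ-+ _ _) (ℂ-ring.+-congˡ {1#} (fromℝ-× n)))

  fromℝ-ι : ∀ i → fromℝ (ℝ.ι i) ≈ fromℤ i
  fromℝ-ι (+ n)    = fromℝ-× n
  fromℝ-ι -[1+ n ] = ℂ-ring.trans (fromℝ-neg _) (ℂ-ring.-‿cong (fromℝ-× (suc n)))

-- Eisenstein integers

IsSqrt3 : (R : CompleteOrderedField) → CompleteOrderedField.Carrier R → Set
IsSqrt3 R x = 0# < x × x * x ≈ 1# + 1# + 1#
  where open CompleteOrderedField R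

module EisensteinProperties
  (R : CompleteOrderedField) (√3 : CompleteOrderedField.Carrier R) (isSqrt3 : IsSqrt3 R √3) where

  open Complex R

  open ComplexProperties R public
  open Eisenstein √3 public

  private
    0<√3 : 0ʳ <ʳ √3
    0<√3 = proj₁ isSqrt3

    √3² : √3 *ʳ √3 ≈ʳ 1ʳ +ʳ 1ʳ +ʳ 1ʳ
    √3² = proj₂ isSqrt3

  half : ℝ
  half = (1ʳ +ʳ 1ʳ) ⁻¹ʳ

  2*half : (1ʳ +ʳ 1ʳ) *ʳ half ≈ʳ 1ʳ
  2*half = ℝ.⁻¹-inverseʳ (ℝ.0<⇒≉0 ℝ.0<2)

  0<half : 0ʳ <ʳ half
  0<half = ℝ.*-cancelˡ-< (inj₁ ℝ.0<2)
    (ℝ.<-respˡ-≈ (ℝ.sym (ℝ.zeroʳ _)) (ℝ.<-respʳ-≈ (ℝ.sym 2*half) ℝ.0<1))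

  private
    2≉0 : fromℤ (+ 2) ≉ 0#
    2≉0 (2≈0 , _) = ℝ.irrefl (ℝ.sym 2≈0) (ℝ.0<1 ℝ.0<+ (ℝ.0≤1 ℝ.0≤+ inj₂ ℝ.refl))

  module _ where
    open ℂ-ι using (solve; con; _:+_; _:*_; _:-_; :-_; _:=_)

    2*2⁻¹ : (1# + 1#) * 2⁻¹ ≈ 1#
    2*2⁻¹ = ℂ-ring.trans (ℂ-ring.*-congʳ {2⁻¹} (ℂ-ring.+-congˡ {1#} (ℂ-ring.sym (ℂ-ring.+-identityʳ 1#)))) (⁻¹-inverseʳ 2≉0)

    √-3² : √-3 * √-3 ≈ - (1# + 1# + 1#)
    √-3² = ℝ.linear-combination (-ʳ 1ʳ) √3²
        (ℝ.solve 1 (λ s → ℝ.con (+ 0) ℝ.:* ℝ.con (+ 0) ℝ.:- s ℝ.:* s ℝ.:- ℝ.:- ℝ.con (+ 3)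
          ℝ.:= ℝ.:- ℝ.con (+ 1) ℝ.:* (s ℝ.:* s ℝ.:- ℝ.con (+ 3))) ℝ.refl √3)
      , ℝ.solve 1 (λ s → ℝ.con (+ 0) ℝ.:* s ℝ.:+ s ℝ.:* ℝ.con (+ 0)
          ℝ.:= ℝ.:- (ℝ.con (+ 0) ℝ.:+ ℝ.con (+ 0) ℝ.:+ ℝ.con (+ 0))) ℝ.refl √3

    -- (1 + s)² = 1 + 2 s - 3 = 2 (s - 1) for s = √-3.
    ζ² : ζ * ζ ≈ ζ - 1#
    ζ² = ℂ-ι.linear-combination₂ (2⁻¹ * 2⁻¹) (√-3 * 2⁻¹ - 2⁻¹ - 1#) √-3² 2*2⁻¹
      (solve 2 (λ s h →
        (con (+ 1) :+ con (+ 0) :+ s) :* h :* ((con (+ 1) :+ con (+ 0) :+ s) :* h)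
          :- ((con (+ 1) :+ con (+ 0) :+ s) :* h :- con (+ 1))
        := h :* h :* (s :* s :- :- con (+ 3)) :+ (s :* h :- h :- con (+ 1)) :* (con (+ 2) :* h :- con (+ 1)))
        ℂ-ring.refl √-3 2⁻¹)

    η≈1+ζ : η ≈ 1# + ζ
    η≈1+ζ = ℂ-ι.linear-combination 1# 2*2⁻¹
      (solve 2 (λ s h →
        -- `fromℤ (+ 3)` unfolds to `1# + (1# + (1# + 0#))`, hence the written-out sum in place of
        -- `con (+ 3)`.
        (con (+ 1) :+ (con (+ 1) :+ (con (+ 1) :+ con (+ 0))) :+ s) :* h
          :- (con (+ 1) :+ (con (+ 1) :+ con (+ 0) :+ s) :* h)
        := con (+ 1) :* (con (+ 2) :* h :- con (+ 1))) ℂ-ring.refl √-3 2⁻¹)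

    -- Uniqueness of the inverse of 2: one side comes from complex inversion, the other from real
    -- inversion.
    2⁻¹≈half : 2⁻¹ ≈ fromℝ half
    2⁻¹≈half = ℂ-ι.linear-combination₂ (fromℝ half) (- 2⁻¹) 2*2⁻¹ 2*fromℝ-half
      (solve 2 (λ h g → h :- g := g :* (con (+ 2) :* h :- con (+ 1)) :+ :- h :* (con (+ 2) :* g :- con (+ 1)))
        ℂ-ring.refl 2⁻¹ (fromℝ half))
      where
      2*fromℝ-half : (1# + 1#) * fromℝ half ≈ 1#
      2*fromℝ-half =
          ℝ.linear-combination 1ʳ 2*half
            (ℝ.solve 1 (λ h → ℝ.con (+ 2) ℝ.:* h ℝ.:- (ℝ.con (+ 0) ℝ.:+ ℝ.con (+ 0)) ℝ.:* ℝ.con (+ 0) ℝ.:- ℝ.con (+ 1)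
              ℝ.:= ℝ.con (+ 1) ℝ.:* (ℝ.con (+ 2) ℝ.:* h ℝ.:- ℝ.con (+ 1))) ℝ.refl half)
        , ℝ.solve 1 (λ h → ℝ.con (+ 2) ℝ.:* ℝ.con (+ 0) ℝ.:+ (ℝ.con (+ 0) ℝ.:+ ℝ.con (+ 0)) ℝ.:* h
              ℝ.:= ℝ.con (+ 0)) ℝ.refl half

  ζ≈ : ζ ≈ half +i (√3 *ʳ half)
  ζ≈ = ℂ-ring.trans (ℂ-ring.*-congˡ {fromℤ (+ 1) + √-3} 2⁻¹≈half)
    ( solve 2 (λ h s → (con (+ 1) :+ con (+ 0) :+ con (+ 0)) :* h :- (con (+ 0) :+ con (+ 0) :+ s) :* con (+ 0) := h)
        ℝ.refl half √3
    , solve 2 (λ h s → (con (+ 1) :+ con (+ 0) :+ con (+ 0)) :* con (+ 0) :+ (con (+ 0) :+ con (+ 0) :+ s) :* h := s :* h)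
        ℝ.refl half √3 )
    where open ℝ using (solve; con; _:+_; _:*_; _:-_; :-_; _:=_)

  -- Oblique coordinates: in the basis 1, `ζ` the lattice `𝔬` is the integer grid, so reduction
  -- modulo `𝔬` amounts to two floors.
  ⟨_,_⟩ : ℝ → ℝ → ℂ
  ⟨ x , y ⟩ = fromℝ x + fromℝ y * ζ

  module _ where
    open ℝ using (solve; con; _:+_; _:*_; _:-_; :-_; _:=_)

    ⟨,⟩≈ : ∀ x y → ⟨ x , y ⟩ ≈ (x +ʳ y *ʳ half) +i (y *ʳ (√3 *ʳ half))
    ⟨,⟩≈ x y = ℂ-ring.trans (ℂ-ring.+-congˡ {fromℝ x} (ℂ-ring.*-congˡ {fromℝ y} ζ≈))
      ( solve 4 (λ x y h k → x :+ (y :* h :- con (+ 0) :* k) := x :+ y :* h) ℝ.refl x y half k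
      , solve 3 (λ y h k → con (+ 0) :+ (y :* k :+ con (+ 0) :* h) := y :* k) ℝ.refl y half k )
      where k = √3 *ʳ half

    -- The cross term has coefficient `2 * half = 1`, and the coefficient of `y²` is
    -- `half² * (1 + 3) = 1`.
    N-⟨,⟩ : ∀ x y → ∣ ⟨ x , y ⟩ ∣² ≈ʳ x *ʳ x +ʳ x *ʳ y +ʳ y *ʳ y
    N-⟨,⟩ x y = ℝ.trans (N-cong (⟨,⟩≈ x y))
      (ℝ.linear-combination₂ (y *ʳ y *ʳ half *ʳ half)
        (x *ʳ y +ʳ y *ʳ y *ʳ ((1ʳ +ʳ 1ʳ) *ʳ half +ʳ 1ʳ)) √3² 2*half
        (solve 4 (λ x y h s →
          (x :+ y :* h) :* (x :+ y :* h) :+ y :* (s :* h) :* (y :* (s :* h)) :- (x :* x :+ x :* y :+ y :* y)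
          := y :* y :* h :* h :* (s :* s :- con (+ 3))
             :+ (x :* y :+ y :* y :* (con (+ 2) :* h :+ con (+ 1))) :* (con (+ 2) :* h :- con (+ 1)))
          ℝ.refl x y half √3))

    coordinates : ∀ v → ∃[ x ] ∃[ y ] v ≈ ⟨ x , y ⟩
    coordinates (a +i b) = a +ʳ -ʳ (y *ʳ half) , y , ℂ-ring.sym (ℂ-ring.trans (⟨,⟩≈ _ y)
      ( solve 3 (λ a y h → a :- y :* h :+ y :* h := a) ℝ.refl a y half
      , ℝ.linear-combination b (ℝ.⁻¹-inverseʳ (ℝ.0<⇒≉0 (ℝ.*-pos 0<√3 0<half)))
          (solve 3 (λ b k k⁻¹ → b :* k⁻¹ :* k :- b := b :* (k :* k⁻¹ :- con (+ 1)))
            ℝ.refl b k (k ⁻¹ʳ)) ))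
      where
      k = √3 *ʳ half
      y = b *ʳ k ⁻¹ʳ

-- Lattice points close to a given point of the plane

module TriangleLemma (F : CompleteOrderedField) where

  open OrderedField F

  0≤x+y≈0⇒x≈0 : ∀ {x y} → 0# ≤ x → 0# ≤ y → x + y ≈ 0# → x ≈ 0#
  0≤x+y≈0⇒x≈0 (inj₁ 0<x) 0≤y x+y≈0 = ⊥-elim (irrefl (sym x+y≈0) (0<x 0<+ 0≤y))
  0≤x+y≈0⇒x≈0 (inj₂ 0≈x) _   _     = sym 0≈x

  x²≈0⇒x≈0 : ∀ {x} → x * x ≈ 0# → x ≈ 0#
  x²≈0⇒x≈0 {x} x²≈0 with compare x 0#
  ... | tri< _ x≉0 _ = ⊥-elim (0<⇒≉0 (0<x² x≉0) x²≈0)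
  ... | tri≈ _ x≈0 _ = x≈0
  ... | tri> _ x≉0 _ = ⊥-elim (0<⇒≉0 (0<x² x≉0) x²≈0)

  -- The norm of `η * ⟨ u , v ⟩`, in view of `∣ η ∣² = 3`. The critical value 1 corresponds to
  -- `⟨ u , v ⟩` having length `1 / √3`, the circumradius of an equilateral triangle of side 1.
  Q₃ : Carrier → Carrier → Carrier
  Q₃ u v = (1# + 1# + 1#) * (u * u + u * v + v * v)

  -- With suitable α and β the sign of α * u + β * v decides whether the denominator grows.
  Good : (α β u v : Carrier) → Set
  Good α β u v = Q₃ u v < 1# ⊎ (Q₃ u v ≈ 1# × 0# ≤ α * u + β * v)

  Good-resp : ∀ {α β u u′ v v′} → u ≈ u′ → v ≈ v′ → Good α β u v → Good α β u′ v′
  Good-resp u≈ v≈ = λ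
    { (inj₁ Q<1)         → inj₁ (<-respˡ-≈ Q≈ Q<1)
    ; (inj₂ (Q≈1 , 0≤L)) → inj₂ (trans (sym Q≈) Q≈1 , ≤-respʳ-≈ (+-cong (*-congˡ u≈) (*-congˡ v≈)) 0≤L) }
    where
    Q≈ = *-congˡ (+-cong (+-cong (*-cong u≈ u≈) (*-cong u≈ v≈)) (*-cong v≈ v≈))

  Good-neg : ∀ {α β u v} → Good (- α) (- β) u v → Good α β (- u) (- v)
  Good-neg {α} {β} {u} {v} = λ
    { (inj₁ Q<1)         → inj₁ (<-respˡ-≈ Q≈ Q<1)
    ; (inj₂ (Q≈1 , 0≤L)) → inj₂ (trans (sym Q≈) Q≈1 ,
        ≤-respʳ-≈ (solve 4 (λ α β u v → :- α :* u :+ :- β :* v := α :* :- u :+ β :* :- v) refl α β u v) 0≤L) }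
    where
    Q≈ : Q₃ u v ≈ Q₃ (- u) (- v)
    Q≈ = solve 2 (λ u v → con (+ 3) :* (u :* u :+ u :* v :+ v :* v)
      := con (+ 3) :* (:- u :* :- u :+ :- u :* :- v :+ :- v :* :- v)) refl u v

  NearLattice : (α β x y : Carrier) → Set
  NearLattice α β x y = ∃[ i ] ∃[ j ] Good α β (ι i - x) (ι j - y)

  2# 3# : Carrier
  2# = 1# + 1#
  3# = 1# + 1# + 1#

  -- With barycentric coordinates t of (x , y) in the triangle (0,0), (1,0), (0,1),
  -- the weighted mean of the values of Q₃ at the differences to the vertices is
  -- 1 - Σ (tᵢ - tⱼ)² / 2.
  variance : ∀ x y → let t = 1# - x - y in
    (x - y) * (x - y) + ((x - t) * (x - t) + (y - t) * (y - t)) +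
    2# * (t * (Q₃ (0# - x) (0# - y) - 1#) + x * (Q₃ (1# - x) (0# - y) - 1#)
                                        + y * (Q₃ (0# - x) (1# - y) - 1#)) ≈ 0#
  variance = solve 2 (λ x y →
    let t = con (+ 1) :- x :- y
        Q = λ u v → con (+ 3) :* (u :* u :+ u :* v :+ v :* v) in
    (x :- y) :* (x :- y) :+ ((x :- t) :* (x :- t) :+ (y :- t) :* (y :- t)) :+
    con (+ 2) :* (t :* (Q (con (+ 0) :- x) (con (+ 0) :- y) :- con (+ 1))
      :+ x :* (Q (con (+ 1) :- x) (con (+ 0) :- y) :- con (+ 1))
      :+ y :* (Q (con (+ 0) :- x) (con (+ 1) :- y) :- con (+ 1))) := con (+ 0)) refl

  -- If `Q₃` is at least 1 at all three vertices, every summand in `variance` is nonnegative, so the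
  -- three squares vanish: the barycentric coordinates coincide and each equals 1/3.
  barycentre : ∀ {x y} → 0# ≤ x → 0# ≤ y → 0# ≤ 1# - x - y →
    1# ≤ Q₃ (0# - x) (0# - y) → 1# ≤ Q₃ (1# - x) (0# - y) → 1# ≤ Q₃ (0# - x) (1# - y) →
    x - y ≈ 0# × 3# * x ≈ 1#
  barycentre {x} {y} 0≤x 0≤y 0≤t 1≤Q₀ 1≤Q₁ 1≤Q₂ = x-y≈0 ,
    linear-combination₂ 1# 1# x-y≈0 x-t≈0
      (solve 2 (λ x y → con (+ 3) :* x :- con (+ 1)
        := con (+ 1) :* (x :- y :- con (+ 0)) :+ con (+ 1) :* (x :- (con (+ 1) :- x :- y) :- con (+ 0))) refl x y)
    where
    t a b c : Carrier
    t = 1# - x - y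
    a = (x - y) * (x - y)
    b = (x - t) * (x - t)
    c = (y - t) * (y - t)

    a+b+c≈0 : a + (b + c) ≈ 0#
    a+b+c≈0 = 0≤x+y≈0⇒x≈0 (0≤x² (x - y) 0≤+ (0≤x² (x - t) 0≤+ 0≤x² (y - t)))
      (inj₁ 0<2 0≤* (0≤t 0≤* ≤⇒0≤ 1≤Q₀ 0≤+ 0≤x 0≤* ≤⇒0≤ 1≤Q₁ 0≤+ 0≤y 0≤* ≤⇒0≤ 1≤Q₂))
      (variance x y)

    x-y≈0 : x - y ≈ 0#
    x-y≈0 = x²≈0⇒x≈0 (0≤x+y≈0⇒x≈0 (0≤x² (x - y)) (0≤x² (x - t) 0≤+ 0≤x² (y - t)) a+b+c≈0)

    x-t≈0 : x - t ≈ 0#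
    x-t≈0 = x²≈0⇒x≈0 (0≤x+y≈0⇒x≈0 (0≤x² (x - t)) (0≤x² (x - y) 0≤+ 0≤x² (y - t))
      (trans (solve 3 (λ a b c → b :+ (a :+ c) := a :+ (b :+ c)) refl a b c) a+b+c≈0))

  module _ {x y} (x-y≈0 : x - y ≈ 0#) (3x≈1 : 3# * x ≈ 1#) where

    Q₀≈1 : Q₃ (0# - x) (0# - y) ≈ 1#
    Q₀≈1 = linear-combination₂ (- 3# * (2# * x + y)) (3# * x + 1#) x-y≈0 3x≈1
      (solve 2 (λ x y →
        let Q = λ u v → con (+ 3) :* (u :* u :+ u :* v :+ v :* v) in
        Q (con (+ 0) :- x) (con (+ 0) :- y) :- con (+ 1)
        := :- con (+ 3) :* (con (+ 2) :* x :+ y) :* (x :- y :- con (+ 0))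
           :+ (con (+ 3) :* x :+ con (+ 1)) :* (con (+ 3) :* x :- con (+ 1))) refl x y)

    Q₁≈1 : Q₃ (1# - x) (0# - y) ≈ 1#
    Q₁≈1 = linear-combination₂ (3# * (1# - 2# * x - y)) (3# * x - 2#) x-y≈0 3x≈1
      (solve 2 (λ x y →
        let Q = λ u v → con (+ 3) :* (u :* u :+ u :* v :+ v :* v) in
        Q (con (+ 1) :- x) (con (+ 0) :- y) :- con (+ 1)
        := con (+ 3) :* (con (+ 1) :- con (+ 2) :* x :- y) :* (x :- y :- con (+ 0))
           :+ (con (+ 3) :* x :- con (+ 2)) :* (con (+ 3) :* x :- con (+ 1))) refl x y)

    Q₂≈1 : Q₃ (0# - x) (1# - y) ≈ 1#
    Q₂≈1 = linear-combination₂ (3# * (2# - 2# * x - y)) (3# * x - 2#) x-y≈0 3x≈1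
      (solve 2 (λ x y →
        let Q = λ u v → con (+ 3) :* (u :* u :+ u :* v :+ v :* v) in
        Q (con (+ 0) :- x) (con (+ 1) :- y) :- con (+ 1)
        := con (+ 3) :* (con (+ 2) :- con (+ 2) :* x :- y) :* (x :- y :- con (+ 0))
           :+ (con (+ 3) :* x :- con (+ 2)) :* (con (+ 3) :* x :- con (+ 1))) refl x y)

    -- The differences from the centre to the three vertices sum to zero, hence so do the values of
    -- any linear form on them, and these cannot all be negative.
    linear-sum≈0 : ∀ α β → let L = λ u v → α * u + β * v in
      - L (0# - x) (0# - y) + (- L (1# - x) (0# - y) + - L (0# - x) (1# - y)) ≈ 0#
    linear-sum≈0 α β = linear-combination₂ (α + β) (- 3# * β) 3x≈1 x-y≈0
      (solve 4 (λ α β x y →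
        let L = λ u v → α :* u :+ β :* v in
        :- L (con (+ 0) :- x) (con (+ 0) :- y) :+ (:- L (con (+ 1) :- x) (con (+ 0) :- y)
          :+ :- L (con (+ 0) :- x) (con (+ 1) :- y)) :- con (+ 0)
        := (α :+ β) :* (con (+ 3) :* x :- con (+ 1)) :+ :- con (+ 3) :* β :* (x :- y :- con (+ 0))) refl α β x y)

    near-barycentre : ∀ α β → NearLattice α β x y
    near-barycentre α β
      with <-or-≥ (α * (0# - x) + β * (0# - y)) 0#
         | <-or-≥ (α * (1# - x) + β * (0# - y)) 0#
         | <-or-≥ (α * (0# - x) + β * (1# - y)) 0#
    ... | inj₂ 0≤L | _        | _        = + 0 , + 0 , inj₂ (Q₀≈1 , 0≤L)
    ... | inj₁ _   | inj₂ 0≤L | _        = + 1 , + 0 , inj₂ (Q₁≈1 , 0≤L)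
    ... | inj₁ _   | inj₁ _   | inj₂ 0≤L = + 0 , + 1 , inj₂ (Q₂≈1 , 0≤L)
    ... | inj₁ L₀<0 | inj₁ L₁<0 | inj₁ L₂<0 = ⊥-elim
      (irrefl (sym (linear-sum≈0 α β)) (0<-neg L₀<0 0<+ inj₁ (0<-neg L₁<0 0<+ inj₁ (0<-neg L₂<0))))

  near-lower : ∀ α β {x y} → 0# ≤ x → 0# ≤ y → 0# ≤ 1# - x - y → NearLattice α β x y
  near-lower α β {x} {y} 0≤x 0≤y 0≤t
    with <-or-≥ (Q₃ (0# - x) (0# - y)) 1# | <-or-≥ (Q₃ (1# - x) (0# - y)) 1# | <-or-≥ (Q₃ (0# - x) (1# - y)) 1#
  ... | inj₁ Q<1 | _        | _        = + 0 , + 0 , inj₁ Q<1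
  ... | inj₂ _   | inj₁ Q<1 | _        = + 1 , + 0 , inj₁ Q<1
  ... | inj₂ _   | inj₂ _   | inj₁ Q<1 = + 0 , + 1 , inj₁ Q<1
  ... | inj₂ 1≤Q₀ | inj₂ 1≤Q₁ | inj₂ 1≤Q₂ =
    let x-y≈0 , 3x≈1 = barycentre 0≤x 0≤y 0≤t 1≤Q₀ 1≤Q₁ 1≤Q₂ in near-barycentre x-y≈0 3x≈1 α β

  ι[1-i]-x : ∀ i x → - (ι i - (1# - x)) ≈ ι (+ 1 ℤ.- i) - x
  ι[1-i]-x i x = linear-combination (- 1#) (trans (ι-+ (+ 1) (ℤ.- i)) (+-congˡ (ι-neg i)))
    (solve 3 (λ i j x → :- (i :- (con (+ 1) :- x)) :- (j :- x) := :- con (+ 1) :* (j :- (con (+ 1) :- i)))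
      refl (ι i) (ι (+ 1 ℤ.- i)) x)

  -- Reflection in the centre of the unit cell preserves the lattice and negates the differences.
  -- `Q₃` is even and the linear form is odd, which is why `α` and `β` change sign.
  near-reflect : ∀ {α β x y} → NearLattice (- α) (- β) (1# - x) (1# - y) → NearLattice α β x y
  near-reflect {α} {β} {x} {y} (i , j , good) = + 1 ℤ.- i , + 1 ℤ.- j ,
    Good-resp {α} {β} (ι[1-i]-x i x) (ι[1-i]-x j y) (Good-neg {α} {β} {ι i - (1# - x)} {ι j - (1# - y)} good)

  1-x-y-reflect : ∀ x y → - (1# - x - y) ≈ 1# - (1# - x) - (1# - y)
  1-x-y-reflect = solve 2 (λ x y → :- (con (+ 1) :- x :- y) := con (+ 1) :- (con (+ 1) :- x) :- (con (+ 1) :- y)) refl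

  -- The diagonal `x + y = 1` cuts the unit cell into two equilateral triangles of side 1, which the
  -- reflection exchanges.
  near-square : ∀ α β {x y} → 0# ≤ x → 0# ≤ 1# - x → 0# ≤ y → 0# ≤ 1# - y → NearLattice α β x y
  near-square α β {x} {y} 0≤x 0≤1-x 0≤y 0≤1-y with <-or-≥ (1# - x - y) 0#
  ... | inj₂ 0≤t = near-lower α β 0≤x 0≤y 0≤t
  ... | inj₁ t<0 = near-reflect (near-lower (- α) (- β) 0≤1-x 0≤1-y
    (≤-respʳ-≈ (1-x-y-reflect x y) (inj₁ (0<-neg t<0))))

  ι[i+j]-x : ∀ i j x → ι j - (x - ι i) ≈ ι (i ℤ.+ j) - x
  ι[i+j]-x i j x = linear-combination (- 1#) (ι-+ i j)
    (solve 4 (λ i j k x → j :- (x :- i) :- (k :- x) := :- con (+ 1) :* (k :- (i :+ j)))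
      refl (ι i) (ι j) (ι (i ℤ.+ j)) x)

  near-shift : ∀ {α β x y} i j → NearLattice α β (x - ι i) (y - ι j) → NearLattice α β x y
  near-shift {α} {β} {x} {y} i j (k , l , good) =
    i ℤ.+ k , j ℤ.+ l , Good-resp {α} {β} (ι[i+j]-x i k x) (ι[i+j]-x j l y) good

  near : ExcludedMiddle 0ℓ → ∀ α β x y → NearLattice α β x y
  near em α β x y =
    let i , 0≤x-i , x-i≤1 = floor em x
        j , 0≤y-j , y-j≤1 = floor em y
    in near-shift i j (near-square α β 0≤x-i x-i≤1 0≤y-j y-j≤1)

-- Arithmetic and discreteness of the Eisenstein integers

module Lattice
  (R : CompleteOrderedField) (√3 : CompleteOrderedField.Carrier R) (isSqrt3 : IsSqrt3 R √3) where

  open Complex R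

  open EisensteinProperties R √3 isSqrt3
  open TriangleLemma R

  private
    ι = ℂ-ι.ι

    𝔬⁺ : ∀ {z} m n → z ≈ ι m + ι n * ζ → z ∈ 𝔬
    𝔬⁺ m n z≈ = m , n , ℂ-ring.trans z≈ (ℂ-ring.sym
      (ℂ-ring.+-cong (fromℤ≈ι m) (ℂ-ring.*-congʳ {ζ} (fromℤ≈ι n))))

    𝔬⁻ : ∀ {z} → z ∈ 𝔬 → ∃[ m ] ∃[ n ] z ≈ ι m + ι n * ζ
    𝔬⁻ (m , n , z≈) = m , n , ℂ-ring.trans z≈
      (ℂ-ring.+-cong (fromℤ≈ι m) (ℂ-ring.*-congʳ {ζ} (fromℤ≈ι n)))

  module _ where
    open ℂ-ι using (solve; con; _:+_; _:*_; _:-_; :-_; _:=_; ι-+; ι-*; ι-neg)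
    open ℂ-ring using (refl; sym; trans; +-cong; +-congˡ; *-cong; *-congʳ; -‿cong)

    𝔬-+ : ∀ {z w} → z ∈ 𝔬 → w ∈ 𝔬 → z + w ∈ 𝔬
    𝔬-+ z∈𝔬 w∈𝔬 =
      let a , b , z≈ = 𝔬⁻ z∈𝔬
          c , d , w≈ = 𝔬⁻ w∈𝔬
      in 𝔬⁺ (a ℤ.+ c) (b ℤ.+ d) (trans (+-cong z≈ w≈) (trans
        (solve 5 (λ a b c d ζ → a :+ b :* ζ :+ (c :+ d :* ζ) := a :+ c :+ (b :+ d) :* ζ)
          refl (ι a) (ι b) (ι c) (ι d) ζ)
        (sym (+-cong (ι-+ a c) (*-congʳ {ζ} (ι-+ b d))))))

    𝔬-* : ∀ {z w} → z ∈ 𝔬 → w ∈ 𝔬 → z * w ∈ 𝔬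
    𝔬-* z∈𝔬 w∈𝔬 =
      let a , b , z≈ = 𝔬⁻ z∈𝔬
          c , d , w≈ = 𝔬⁻ w∈𝔬
      -- The coefficients after replacing `ζ²` by `ζ - 1` in the expanded product.
      in 𝔬⁺ (a ℤ.* c ℤ.+ ℤ.- (b ℤ.* d)) (a ℤ.* d ℤ.+ b ℤ.* c ℤ.+ b ℤ.* d)
        (trans (*-cong z≈ w≈) (trans
        (ℂ-ι.linear-combination (ι b * ι d) ζ²
          (solve 5 (λ a b c d ζ → (a :+ b :* ζ) :* (c :+ d :* ζ) :-
            (a :* c :+ :- (b :* d) :+ (a :* d :+ b :* c :+ b :* d) :* ζ)
            := b :* d :* (ζ :* ζ :- (ζ :- con (+ 1)))) refl (ι a) (ι b) (ι c) (ι d) ζ))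
        (sym (+-cong
          (trans (ι-+ (a ℤ.* c) (ℤ.- (b ℤ.* d))) (+-cong (ι-* a c) (trans (ι-neg (b ℤ.* d)) (-‿cong (ι-* b d)))))
          (*-congʳ {ζ} (trans (ι-+ (a ℤ.* d ℤ.+ b ℤ.* c) (b ℤ.* d))
            (+-cong (trans (ι-+ (a ℤ.* d) (b ℤ.* c)) (+-cong (ι-* a d) (ι-* b c))) (ι-* b d))))))))

    𝔬-resp : ∀ {z w} → z ≈ w → w ∈ 𝔬 → z ∈ 𝔬
    𝔬-resp z≈w (m , n , w≈) = m , n , trans z≈w w≈

    0∈𝔬 : 0# ∈ 𝔬
    0∈𝔬 = 𝔬⁺ (+ 0) (+ 0) (solve 1 (λ ζ → con (+ 0) := con (+ 0) :+ con (+ 0) :* ζ) refl ζ)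

    1∈𝔬 : 1# ∈ 𝔬
    1∈𝔬 = 𝔬⁺ (+ 1) (+ 0) (solve 1 (λ ζ → con (+ 1) := con (+ 1) :+ con (+ 0) :* ζ) refl ζ)

    -1∈𝔬 : - 1# ∈ 𝔬
    -1∈𝔬 = 𝔬⁺ -[1+ 0 ] (+ 0) (solve 1 (λ ζ → :- con (+ 1) := con (-[1+ 0 ]) :+ con (+ 0) :* ζ) refl ζ)

    η∈𝔬 : η ∈ 𝔬
    η∈𝔬 = 𝔬⁺ (+ 1) (+ 1) (trans η≈1+ζ (solve 1 (λ ζ → con (+ 1) :+ ζ := con (+ 1) :+ con (+ 1) :* ζ) refl ζ))

    𝒥⊆𝔬 : ∀ {z} → z ∈ 𝒥 → z ∈ 𝔬
    𝒥⊆𝔬 (a , a∈𝔬 , z≈) = 𝔬-resp z≈ (𝔬-* η∈𝔬 a∈𝔬)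

    fromℤ-lattice : ∀ i j → fromℤ i + fromℤ j * ζ ≈ ⟨ ℝ.ι i , ℝ.ι j ⟩
    fromℤ-lattice i j = sym (+-cong (fromℝ-ι i) (*-congʳ {ζ} (fromℝ-ι j)))

    ⟨,⟩-- : ∀ x y u v → ⟨ x , y ⟩ - ⟨ u , v ⟩ ≈ ⟨ x +ʳ -ʳ u , y +ʳ -ʳ v ⟩
    ⟨,⟩-- x y u v = trans
      (solve 5 (λ x y u v ζ → x :+ y :* ζ :- (u :+ v :* ζ) := x :- u :+ (y :- v) :* ζ)
        refl (fromℝ x) (fromℝ y) (fromℝ u) (fromℝ v) ζ)
      (sym (+-cong (trans (fromℝ-+ x (-ʳ u)) (+-congˡ {fromℝ x} (fromℝ-neg u)))
        (*-congʳ {ζ} (trans (fromℝ-+ y (-ʳ v)) (+-congˡ {fromℝ y} (fromℝ-neg v))))))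

  N-lattice : ∀ i j → ∣ ⟨ ℝ.ι i , ℝ.ι j ⟩ ∣² ≈ʳ ℝ.ι (i ℤ.* i ℤ.+ i ℤ.* j ℤ.+ j ℤ.* j)
  N-lattice i j = ℝ.trans (N-⟨,⟩ (ℝ.ι i) (ℝ.ι j)) (ℝ.sym
    (ℝ.trans (ℝ.ι-+ (i ℤ.* i ℤ.+ i ℤ.* j) (j ℤ.* j)) (ℝ.+-cong
      (ℝ.trans (ℝ.ι-+ (i ℤ.* i) (i ℤ.* j)) (ℝ.+-cong (ℝ.ι-* i i) (ℝ.ι-* i j))) (ℝ.ι-* j j))))

  0<ι⇒1≤ι : ∀ i → 0ʳ <ʳ ℝ.ι i → 1ʳ ≤ʳ ℝ.ι i
  0<ι⇒1≤ι (+ zero)  0<0 = ⊥-elim (ℝ.irrefl ℝ.refl 0<0)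
  0<ι⇒1≤ι (+ suc n) _   = ℝ.1≤ι-suc n
  0<ι⇒1≤ι -[1+ n ]  0<i = ⊥-elim (ℝ.irrefl (ℝ.sym (ℝ.-‿inverseˡ _)) (0<i ℝ.0<+ ℝ.0≤ι (suc n)))

  -- The norm form has integer values on `𝔬`, and a positive integer is at least 1.
  1≤N : ∀ {z} → z ∈ 𝔬 → z ≉ 0# → 1ʳ ≤ʳ ∣ z ∣²
  1≤N {z} (i , j , z≈) z≉0 =
    ℝ.≤-respʳ-≈ (ℝ.sym N≈) (0<ι⇒1≤ι (i ℤ.* i ℤ.+ i ℤ.* j ℤ.+ j ℤ.* j) (ℝ.<-respʳ-≈ N≈ (0<N z≉0)))
    where
    N≈ : ∣ z ∣² ≈ʳ ℝ.ι (i ℤ.* i ℤ.+ i ℤ.* j ℤ.+ j ℤ.* j)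
    N≈ = ℝ.trans (N-cong (ℂ-ring.trans z≈ (fromℤ-lattice i j))) (N-lattice i j)

  4ʳ : ℝ
  4ʳ = 1ʳ +ʳ 1ʳ +ʳ 1ʳ +ʳ 1ʳ

  module _ where
    open ℝ using (solve; con; _:+_; _:*_; _:-_; :-_; _:=_)

    -- Completing the square: `4 (x² + x y + y²) = 3 x² + (x + 2 y)²`.
    x²≤4N : ∀ x y → x *ʳ x ≤ʳ 4ʳ *ʳ ∣ ⟨ x , y ⟩ ∣²
    x²≤4N x y = ℝ.≤-respʳ-≈ (ℝ.*-congˡ (ℝ.sym (N-⟨,⟩ x y)))
      (ℝ.0≤⇒≤ (ℝ.0≤x² x ℝ.0≤+ ℝ.0≤x² x ℝ.0≤+ ℝ.0≤x² (x +ʳ y +ʳ y))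
        (solve 2 (λ x y → con (+ 4) :* (x :* x :+ x :* y :+ y :* y)
          := x :* x :+ (x :* x :+ x :* x :+ (x :+ y :+ y) :* (x :+ y :+ y))) ℝ.refl x y))

    y²≤4N : ∀ x y → y *ʳ y ≤ʳ 4ʳ *ʳ ∣ ⟨ x , y ⟩ ∣²
    y²≤4N x y = ℝ.≤-respʳ-≈ (ℝ.*-congˡ (ℝ.sym (N-⟨,⟩ x y)))
      (ℝ.0≤⇒≤ (ℝ.0≤x² y ℝ.0≤+ ℝ.0≤x² y ℝ.0≤+ ℝ.0≤x² (x +ʳ x +ʳ y))
        (solve 2 (λ x y → con (+ 4) :* (x :* x :+ x :* y :+ y :* y)
          := y :* y :+ (y :* y :+ y :* y :+ (x :+ x :+ y) :* (x :+ x :+ y))) ℝ.refl x y))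

    ι≤ι² : ∀ n → ℝ.ι (+ n) ≤ʳ ℝ.ι (+ n) *ʳ ℝ.ι (+ n)
    ι≤ι² zero    = inj₂ (ℝ.sym (ℝ.zeroˡ _))
    ι≤ι² (suc n) = ℝ.≤-trans (inj₂ (ℝ.sym (ℝ.*-identityʳ _)))
      (ℝ.*-monoʳ-≤ (ℝ.0≤ι (suc n)) (ℝ.1≤ι-suc n))

    ι∣i∣≤ι² : ∀ i → ℝ.ι (+ ℤ.∣ i ∣) ≤ʳ ℝ.ι i *ʳ ℝ.ι i
    ι∣i∣≤ι² (+ n)    = ι≤ι² n
    ι∣i∣≤ι² -[1+ n ] = ℝ.≤-respʳ-≈
      (solve 1 (λ x → x :* x := :- x :* :- x) ℝ.refl (ℝ.ι (+ suc n))) (ι≤ι² (suc n))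

  ι²<⇒∣i∣< : ∀ {i M} → ℝ.ι i *ʳ ℝ.ι i <ʳ ℝ.ι (+ M) → ℤ.∣ i ∣ ℕ.< M
  ι²<⇒∣i∣< {i} {M} i²<M with ℤ.∣ i ∣ Nat.<? M
  ... | yes ∣i∣<M = ∣i∣<M
  ... | no ∣i∣≮M = ⊥-elim (ℝ.<⇒≱ i²<M (ℝ.≤-trans (ℝ.ι-mono-≤ (Nat.≮⇒≥ ∣i∣≮M)) (ι∣i∣≤ι² i)))

  -- Discreteness of `𝔬`: a bound on the norm leaves finitely many integer coordinates. The chain
  -- `∣ i ∣ ≤ i² ≤ 4 ∣ z ∣²` avoids taking a square root of the bound.
  lattice-bound : ∀ {z M} → z ∈ 𝔬 → 4ʳ *ʳ ∣ z ∣² <ʳ ℝ.ι (+ M) →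
    ∃[ i ] ∃[ j ] ℤ.∣ i ∣ ℕ.< M × ℤ.∣ j ∣ ℕ.< M × z ≈ ⟨ ℝ.ι i , ℝ.ι j ⟩
  lattice-bound {z} {M} (i , j , z≈) 4N<M =
    i , j , ι²<⇒∣i∣< {i} (ℝ.≤-<-trans (x²≤4N (ℝ.ι i) (ℝ.ι j)) 4N<M′) ,
            ι²<⇒∣i∣< {j} (ℝ.≤-<-trans (y²≤4N (ℝ.ι i) (ℝ.ι j)) 4N<M′) , z≈′
    where
    z≈′ : z ≈ ⟨ ℝ.ι i , ℝ.ι j ⟩
    z≈′ = ℂ-ring.trans z≈ (fromℤ-lattice i j)
    4N<M′ : 4ʳ *ʳ ∣ ⟨ ℝ.ι i , ℝ.ι j ⟩ ∣² <ʳ ℝ.ι (+ M)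
    4N<M′ = ℝ.<-respˡ-≈ (ℝ.*-congˡ (N-cong z≈′)) 4N<M

  N-η : ∣ η ∣² ≈ʳ 3#
  N-η = ℝ.trans (N-cong (ℂ-ring.trans η≈1+ζ
          (ℂ-ι.solve 1 (λ ζ → ℂ-ι.con (+ 1) ℂ-ι.:+ ζ ℂ-ι.:= ℂ-ι.con (+ 1) ℂ-ι.:+ ℂ-ι.con (+ 1) ℂ-ι.:* ζ) ℂ-ring.refl ζ)))
    (ℝ.trans (N-⟨,⟩ 1ʳ 1ʳ)
      (ℝ.solve 0 (ℝ.con (+ 1) ℝ.:* ℝ.con (+ 1) ℝ.:+ ℝ.con (+ 1) ℝ.:* ℝ.con (+ 1) ℝ.:+ ℝ.con (+ 1) ℝ.:* ℝ.con (+ 1)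
        ℝ.:= ℝ.con (+ 3)) ℝ.refl))

  0<3 : 0ʳ <ʳ 3#
  0<3 = ℝ.0<2 ℝ.0<+ ℝ.0≤1

  -- The choice of the next digit

  infix 4 _⊏_ _⊑_

  -- Lexicographic comparison of the pairs `(- ∣ e ∣ , ∣ q ∣)`. In the second alternative `≤` may
  -- replace equality, since a strict inequality already falls under the first; this makes
  -- transitivity a direct case analysis.
  _⊏_ _⊑_ : ℂ × ℂ → ℂ × ℂ → Set
  (e , q) ⊏ (f , r) = ∣ f ∣² <ʳ ∣ e ∣² ⊎ (∣ f ∣² ≤ʳ ∣ e ∣² × ∣ q ∣² <ʳ ∣ r ∣²)
  (e , q) ⊑ (f , r) = ∣ f ∣² <ʳ ∣ e ∣² ⊎ (∣ f ∣² ≤ʳ ∣ e ∣² × ∣ q ∣² ≤ʳ ∣ r ∣²)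

  η∈𝒥 : η ∈ 𝒥
  η∈𝒥 = 1# , 1∈𝔬 , ℂ-ring.sym (ℂ-ring.*-identityʳ η)

  -η∈𝒥 : - η ∈ 𝒥
  -η∈𝒥 = - 1# , -1∈𝔬 , ℂ-ι.solve 1 (λ η → ℂ-ι.:- η ℂ-ι.:= η ℂ-ι.:* ℂ-ι.:- ℂ-ι.con (+ 1)) ℂ-ring.refl η

  N-grow : ∀ {z} w → z ≉ 0# → 0ʳ ≤ʳ inner z w → ∣ w ∣² <ʳ ∣ z + w ∣²
  N-grow {z} w z≉0 0≤i = ℝ.0<⇒< (0<N z≉0 ℝ.0<+ inj₁ ℝ.0<2 ℝ.0≤* 0≤i)
    (ℝ.trans (N-+ z w) (ℝ.solve 3 (λ a b c → a ℝ.:+ b ℝ.:+ c ℝ.:= b ℝ.:+ (a ℝ.:+ c)) ℝ.refl _ _ _))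

  *-≉0 : ∀ {z w} → z ≉ 0# → w ≉ 0# → z * w ≉ 0#
  *-≉0 {z} {w} z≉0 w≉0 = 0<N⇒≉0 (ℝ.<-respʳ-≈ (ℝ.sym (N-* z w)) (ℝ.*-pos (0<N z≉0) (0<N w≉0)))

  η≉0 : η ≉ 0#
  η≉0 = 0<N⇒≉0 (ℝ.<-respʳ-≈ (ℝ.sym N-η) 0<3)

  inner-neg : ∀ z w → inner (- z) w ≈ʳ -ʳ inner z w
  inner-neg (a +i b) (c +i d) = ℝ.solve 4 (λ a b c d →
    ℝ.:- a ℝ.:* c ℝ.:+ ℝ.:- b ℝ.:* d ℝ.:= ℝ.:- (a ℝ.:* c ℝ.:+ b ℝ.:* d)) ℝ.refl a b c d

  -- The scalar products of `η * q` and `- η * q` with `q′` are opposite, so one of them is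
  -- nonnegative, and adding that vector to `q′` lengthens it.
  enlarge : ∀ {q} q′ → q ≉ 0# → ∃[ b ] b ∈ 𝒥 × ∣ q′ ∣² <ʳ ∣ b * q + q′ ∣²
  enlarge {q} q′ q≉0 with ℝ.<-or-≥ (inner (η * q) q′) 0ʳ
  ... | inj₂ 0≤i = η , η∈𝒥 , N-grow q′ (*-≉0 η≉0 q≉0) 0≤i
  ... | inj₁ i<0 = - η , -η∈𝒥 , N-grow q′ (λ -ηq≈0 → *-≉0 η≉0 q≉0
        (ℂ-ring.trans (ℂ-ι.solve 2 (λ η q → η ℂ-ι.:* q ℂ-ι.:= ℂ-ι.:- (ℂ-ι.:- η ℂ-ι.:* q)) ℂ-ring.refl η q)
          (ℂ-ring.trans (ℂ-ring.-‿cong -ηq≈0) (ℂ-ι.solve 0 (ℂ-ι.:- ℂ-ι.con (+ 0) ℂ-ι.:= ℂ-ι.con (+ 0)) ℂ-ring.refl))))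
      (ℝ.≤-respʳ-≈ -i≈ (inj₁ (ℝ.0<-neg i<0)))
    where
    -i≈ : -ʳ inner (η * q) q′ ≈ʳ inner (- η * q) q′
    -i≈ = ℝ.trans (ℝ.sym (inner-neg (η * q) q′)) (ℝ.+-cong (ℝ.*-congʳ (proj₁ eq)) (ℝ.*-congʳ (proj₂ eq)))
      where
      eq : - (η * q) ≈ - η * q
      eq = ℂ-ι.solve 2 (λ η q → ℂ-ι.:- (η ℂ-ι.:* q) ℂ-ι.:= ℂ-ι.:- η ℂ-ι.:* q) ℂ-ring.refl η q

  -- The source of the coefficients `α` and `β` of `Good`: for fixed `X`, `Y`, `D` the scalar
  -- product is a real linear form in the coordinates `u`, `v`.
  inner-linear : ∀ X Y D u v →
    inner (fromℝ u * X + fromℝ v * Y) D ≈ʳ inner X D *ʳ u +ʳ inner Y D *ʳ v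
  inner-linear (a +i b) (c +i d) (e +i f) u v = solve 8 (λ a b c d e f u v →
    (u :* a :- con (+ 0) :* b :+ (v :* c :- con (+ 0) :* d)) :* e :+
    (u :* b :+ con (+ 0) :* a :+ (v :* d :+ con (+ 0) :* c)) :* f
    := (a :* e :+ b :* f) :* u :+ (c :* e :+ d :* f) :* v) ℝ.refl a b c d e f u v
    where open ℝ using (solve; con; _:+_; _:*_; _:-_; :-_; _:=_)

  inner-congˡ : ∀ {z z′} w → z ≈ z′ → inner z w ≈ʳ inner z′ w
  inner-congˡ w (a , b) = ℝ.+-cong (ℝ.*-congʳ a) (ℝ.*-congʳ b)

  -- The quotient of - e′ by η * e.
  scaled-quotient : ∀ {e} e′ → e ≉ 0# → ∃[ x ] ∃[ y ] η * e * ⟨ x , y ⟩ ≈ - e′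
  scaled-quotient {e} e′ e≉0 =
    let x , y , w≈ = coordinates ((η * e) ⁻¹ * - e′)
    in x , y , ℂ-ring.trans (ℂ-ring.*-congˡ {η * e} (ℂ-ring.sym w≈))
      (ℂ-ring.trans (ℂ-ring.sym (ℂ-ring.*-assoc (η * e) ((η * e) ⁻¹) (- e′)))
        (ℂ-ring.trans (ℂ-ring.*-congʳ { - e′} (⁻¹-inverseʳ (*-≉0 η≉0 e≉0))) (ℂ-ring.*-identityˡ (- e′))))

  module Approximation (em : ExcludedMiddle 0ℓ) {e} (e′ q q′ : ℂ) (e≉0 : e ≉ 0#)
    (unimodular : ∣ q′ * e - e′ * q ∣² ≈ʳ 1ʳ) where

    private
      D : ℂ
      D = q′ * e - e′ * q

      x y : ℝ
      x = proj₁ (scaled-quotient e′ e≉0)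
      y = proj₁ (proj₂ (scaled-quotient e′ e≉0))

      X Y : ℂ
      X = η * e * q
      Y = η * e * ζ * q

      -- With these coefficients the linear form of `Good` is the scalar product of `e₁ * q` and
      -- `D`, which is the cross term in `∣ q₁ * e ∣²`.
      nearest : NearLattice (inner X D) (inner Y D) x y
      nearest = near em (inner X D) (inner Y D) x y

      i j : ℤ
      i = proj₁ nearest
      j = proj₁ (proj₂ nearest)

      u v : ℝ
      u = ℝ.ι i +ʳ -ʳ x
      v = ℝ.ι j +ʳ -ʳ y

    digit : ℂ
    digit = η * (fromℤ i + fromℤ j * ζ)

    digit∈𝒥 : digit ∈ 𝒥
    digit∈𝒥 = fromℤ i + fromℤ j * ζ , (i , j , ℂ-ring.refl) , ℂ-ring.refl

    private
      e₁ q₁ : ℂ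
      e₁ = digit * e + e′
      q₁ = digit * q + q′

      -- Since `- e′` is `η * e` times the quotient `⟨ x , y ⟩`, the new error is `η * e` times the
      -- difference between the chosen lattice point and that quotient.
      e₁≈ : e₁ ≈ η * e * ⟨ u , v ⟩
      e₁≈ = ℂ-ring.trans
        (ℂ-ι.linear-combination₂ (η * e) 1# (fromℤ-lattice i j) (proj₂ (proj₂ (scaled-quotient e′ e≉0)))
          (solve 6 (λ η e e′ l m w → η :* l :* e :+ e′ :- η :* e :* (m :- w)
             := η :* e :* (l :- m) :+ con (+ 1) :* (η :* e :* w :- :- e′))
            ℂ-ring.refl η e e′ (fromℤ i + fromℤ j * ζ) ⟨ ℝ.ι i , ℝ.ι j ⟩ ⟨ x , y ⟩))
        (ℂ-ring.*-congˡ {η * e} (⟨,⟩-- (ℝ.ι i) (ℝ.ι j) x y))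
        where open ℂ-ι using (solve; con; _:+_; _:*_; _:-_; :-_; _:=_)

      N-e₁ : ∣ e₁ ∣² ≈ʳ ∣ e ∣² *ʳ Q₃ u v
      N-e₁ = begin
        ∣ e₁ ∣²                                ≈⟨ N-cong e₁≈ ⟩
        ∣ η * e * ⟨ u , v ⟩ ∣²                 ≈⟨ N-* (η * e) ⟨ u , v ⟩ ⟩
        ∣ η * e ∣² *ʳ ∣ ⟨ u , v ⟩ ∣²           ≈⟨ ℝ.*-cong (N-* η e) (N-⟨,⟩ u v) ⟩
        ∣ η ∣² *ʳ ∣ e ∣² *ʳ form               ≈⟨ ℝ.*-congʳ (ℝ.*-congʳ N-η) ⟩
        3# *ʳ ∣ e ∣² *ʳ form                   ≈⟨ ℝ.*-congʳ (ℝ.*-comm 3# ∣ e ∣²) ⟩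
        ∣ e ∣² *ʳ 3# *ʳ form                   ≈⟨ ℝ.*-assoc ∣ e ∣² 3# form ⟩
        ∣ e ∣² *ʳ Q₃ u v                       ∎
        where
        open SetoidReasoning ℝ.setoid
        form = u *ʳ u +ʳ u *ʳ v +ʳ v *ʳ v

      q₁e≈ : q₁ * e ≈ e₁ * q + D
      q₁e≈ = solve 5 (λ b e e′ q q′ → (b :* q :+ q′) :* e := (b :* e :+ e′) :* q :+ (q′ :* e :- e′ :* q))
        ℂ-ring.refl digit e e′ q q′
        where open ℂ-ι using (solve; _:+_; _:*_; _:-_; _:=_)

      e₁q≈ : e₁ * q ≈ fromℝ u * X + fromℝ v * Y
      e₁q≈ = ℂ-ring.trans (ℂ-ring.*-congʳ {q} e₁≈)
        (solve 6 (λ η e ζ q u v → η :* e :* (u :+ v :* ζ) :* q := u :* (η :* e :* q) :+ v :* (η :* e :* ζ :* q))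
          ℂ-ring.refl η e ζ q (fromℝ u) (fromℝ v))
        where open ℂ-ι using (solve; _:+_; _:*_; _:-_; _:=_)

      L : ℝ
      L = inner X D *ʳ u +ʳ inner Y D *ʳ v

      -- Norms are taken in `q₁ * e = e₁ * q + D`, where `∣ D ∣² = 1`. If `∣ e₁ ∣ = ∣ e ∣` and `L`
      -- is nonnegative, the surplus `1 + 2 L` is positive and forces `∣ q₁ ∣ > ∣ q ∣`.
      N-q₁e : ∣ e ∣² *ʳ ∣ q₁ ∣² ≈ʳ ∣ e₁ ∣² *ʳ ∣ q ∣² +ʳ (1ʳ +ʳ (1ʳ +ʳ 1ʳ) *ʳ L)
      N-q₁e = begin
        ∣ e ∣² *ʳ ∣ q₁ ∣²                                          ≈⟨ ℝ.*-comm ∣ e ∣² ∣ q₁ ∣² ⟩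
        ∣ q₁ ∣² *ʳ ∣ e ∣²                                          ≈⟨ N-* q₁ e ⟨
        ∣ q₁ * e ∣²                                                ≈⟨ N-cong q₁e≈ ⟩
        ∣ e₁ * q + D ∣²                                            ≈⟨ N-+ (e₁ * q) D ⟩
        ∣ e₁ * q ∣² +ʳ ∣ D ∣² +ʳ (1ʳ +ʳ 1ʳ) *ʳ inner (e₁ * q) D    ≈⟨ ℝ.+-cong (ℝ.+-cong (N-* e₁ q) unimodular)
                                                                       (ℝ.*-congˡ (ℝ.trans (inner-congˡ D e₁q≈) (inner-linear X Y D u v))) ⟩
        ∣ e₁ ∣² *ʳ ∣ q ∣² +ʳ 1ʳ +ʳ (1ʳ +ʳ 1ʳ) *ʳ L                 ≈⟨ ℝ.+-assoc _ _ _ ⟩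
        ∣ e₁ ∣² *ʳ ∣ q ∣² +ʳ (1ʳ +ʳ (1ʳ +ʳ 1ʳ) *ʳ L)               ∎
        where open SetoidReasoning ℝ.setoid

      advance-from : Good (inner X D) (inner Y D) u v → (e , q) ⊏ (e₁ , q₁)
      advance-from (inj₁ Q<1) = inj₁ (ℝ.<-respˡ-≈ (ℝ.sym N-e₁)
        (ℝ.<-respʳ-≈ (ℝ.*-identityʳ ∣ e ∣²) (ℝ.*-monoʳ-< (0<N e≉0) Q<1)))
      advance-from (inj₂ (Q≈1 , 0≤L)) = inj₂ (inj₂ e₁≈e , ℝ.*-cancelˡ-< (0≤N e)
        (ℝ.<-respˡ-≈ (ℝ.*-congʳ e₁≈e) (ℝ.0<⇒< (ℝ.0<1 ℝ.0<+ inj₁ ℝ.0<2 ℝ.0≤* 0≤L) N-q₁e)))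
        where
        e₁≈e : ∣ e₁ ∣² ≈ʳ ∣ e ∣²
        e₁≈e = ℝ.trans N-e₁ (ℝ.trans (ℝ.*-congˡ Q≈1) (ℝ.*-identityʳ ∣ e ∣²))

    advance : (e , q) ⊏ (digit * e + e′ , digit * q + q′)
    advance = advance-from (proj₂ (proj₂ nearest))

-- The expansion and its convergence

Eventually : (ℕ → Set) → Set
Eventually P = ∃[ N ] (∀ n → N ℕ.≤ n → P n)

Eventually-× : ∀ {P Q} → Eventually P → Eventually Q → Eventually (λ n → P n × Q n)
Eventually-× (M , p) (N , q) = M ℕ.⊔ N , λ n ≤n →
  p n (Nat.≤-trans (Nat.m≤m⊔n M N) ≤n) , q n (Nat.≤-trans (Nat.m≤n⊔m M N) ≤n)

-- A finite intersection of eventual conditions: passing from `M` to `suc M` adds only the integers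
-- `M` and `- M`.
Eventually-bounded : ∀ {P : ℤ → ℕ → Set} → (∀ i → Eventually (P i)) →
  ∀ M → Eventually (λ n → ∀ i → ℤ.∣ i ∣ ℕ.< M → P i n)
Eventually-bounded ev zero = 0 , λ _ _ _ ()
Eventually-bounded {P} ev (suc M) =
  let N , below = Eventually-× (Eventually-bounded ev M) (Eventually-× (ev (+ M)) (ev (ℤ.- + M)))
  in N , λ n N≤n → extend (below n N≤n)
  where
  extend : ∀ {n} → (∀ i → ℤ.∣ i ∣ ℕ.< M → P i n) × P (+ M) n × P (ℤ.- + M) n →
           ∀ i → ℤ.∣ i ∣ ℕ.< suc M → P i n
  extend (below , P₊ , P₋) i (s≤s ∣i∣≤M) with Nat.m≤n⇒m<n∨m≡n ∣i∣≤M
  ... | inj₁ ∣i∣<M = below i ∣i∣<M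
  extend (below , P₊ , P₋) (+ _)    _ | inj₂ ≡.refl = P₊
  extend (below , P₊ , P₋) -[1+ _ ] _ | inj₂ ≡.refl = P₋

module Expansion
  (em : ExcludedMiddle 0ℓ)
  (R : CompleteOrderedField) (√3 : CompleteOrderedField.Carrier R) (isSqrt3 : IsSqrt3 R √3)
  (z : Complex.ℂ R) (N-z≤1 : CompleteOrderedField._≤_ R (Complex.∣_∣² R z) (CompleteOrderedField.1# R)) where

  open Complex R

  open EisensteinProperties R √3 isSqrt3
  open ℂ-ι using (solve; con; _:+_; _:*_; _:-_; :-_; _:=_)
  open Lattice R √3 isSqrt3

  error : ℂ → ℂ → ℂ
  error p q = q * z - p

  error-cong : ∀ {p p′ q q′} → p ≈ p′ → q ≈ q′ → error p q ≈ error p′ q′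
  error-cong p≈ q≈ = ℂ-ring.+-cong (ℂ-ring.*-congʳ {z} q≈) (ℂ-ring.-‿cong p≈)

  -- Two consecutive terms of both recurrences. The determinant in `unimodular` changes sign at each
  -- step; taking its norm gives an invariant of constant form.
  record State : Set where
    field
      p₀ p₋ q₀ q₋ : ℂ
      p₀∈𝔬 : p₀ ∈ 𝔬
      p₋∈𝔬 : p₋ ∈ 𝔬
      q₀∈𝔬 : q₀ ∈ 𝔬
      q₋∈𝔬 : q₋ ∈ 𝔬
      unimodular : ∣ q₋ * error p₀ q₀ - error p₋ q₋ * q₀ ∣² ≈ʳ 1ʳ
    e₀ e₋ : ℂ
    e₀ = error p₀ q₀
    e₋ = error p₋ q₋

  open State

  Advance : State → ℂ → Set
  Advance S b = (e₀ S ≉ 0# × (e₀ S , q₀ S) ⊏ new) ⊎ (e₀ S ≈ 0# × (e₋ S , q₋ S) ⊏ new)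
    where new = error (b * p₀ S + p₋ S) (b * q₀ S + q₋ S) , b * q₀ S + q₋ S

  ⊏-respʳ : ∀ {x f f′ r} → f ≈ f′ → x ⊏ (f , r) → x ⊏ (f′ , r)
  ⊏-respʳ f≈ (inj₁ f<)       = inj₁ (ℝ.<-respˡ-≈ (N-cong f≈) f<)
  ⊏-respʳ f≈ (inj₂ (f≤ , q<)) = inj₂ (ℝ.≤-trans (inj₂ (N-cong (ℂ-ring.sym f≈))) f≤ , q<)

  error-step : ∀ b p p′ q q′ → b * error p q + error p′ q′ ≈ error (b * p + p′) (b * q + q′)
  error-step b p p′ q q′ = solve 6 (λ b p p′ q q′ z → b :* (q :* z :- p) :+ (q′ :* z :- p′)
    := (b :* q :+ q′) :* z :- (b :* p :+ p′)) ℂ-ring.refl b p p′ q q′ z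

  -- A determinant with a vanishing row is zero. The row is either a pair of consecutive errors or
  -- the pair `p₀`, `q₀` of one state.
  degenerate : ∀ {a b c d} → a ≈ 0# → b ≈ 0# → ∣ c * a - b * d ∣² ≈ʳ 1ʳ → ⊥
  degenerate {a} {b} {c} {d} a≈0 b≈0 N≈1 = ℝ.irrefl
    (ℝ.trans (ℝ.sym N-0) (ℝ.trans (N-cong (ℂ-ring.sym zero≈)) N≈1)) ℝ.0<1
    where
    zero≈ : c * a - b * d ≈ 0#
    zero≈ = ℂ-ι.linear-combination₂ c (- d) a≈0 b≈0
      (solve 4 (λ a b c d → c :* a :- b :* d :- con (+ 0) := c :* (a :- con (+ 0)) :+ :- d :* (b :- con (+ 0)))
        ℂ-ring.refl a b c d)

  -- The terms with `z` cancel, which leaves the determinant of the numerators and denominators up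
  -- to sign.
  unimodular-pq : ∀ S → ∣ p₀ S * q₋ S - p₋ S * q₀ S ∣² ≈ʳ 1ʳ
  unimodular-pq S = ℝ.trans (ℝ.sym (N-neg _)) (ℝ.trans (N-cong
    (solve 5 (λ p p′ q q′ z → :- (p :* q′ :- p′ :* q) := q′ :* (q :* z :- p) :- (q′ :* z :- p′) :* q)
      ℂ-ring.refl (p₀ S) (p₋ S) (q₀ S) (q₋ S) z)) (unimodular S))

  pq-not-both-zero : ∀ S → p₀ S ≈ 0# → q₀ S ≉ 0#
  pq-not-both-zero S p≈0 q≈0 = degenerate {c = q₋ S} {d = p₋ S} p≈0 q≈0
    (ℝ.trans (N-cong (solve 4 (λ p p′ q q′ → q′ :* p :- q :* p′ := p :* q′ :- p′ :* q)
      ℂ-ring.refl (p₀ S) (p₋ S) (q₀ S) (q₋ S))) (unimodular-pq S))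

  e≈0∧q≈0⇒p≈0 : ∀ S → e₀ S ≈ 0# → q₀ S ≈ 0# → p₀ S ≈ 0#
  e≈0∧q≈0⇒p≈0 S e≈0 q≈0 = ℂ-ι.linear-combination₂ z (- 1#) q≈0 e≈0
    (solve 3 (λ p q z → p :- con (+ 0) := z :* (q :- con (+ 0)) :+ :- con (+ 1) :* (q :* z :- p :- con (+ 0)))
      ℂ-ring.refl (p₀ S) (q₀ S) z)

  e≈0⇒q≉0 : ∀ S → e₀ S ≈ 0# → q₀ S ≉ 0#
  e≈0⇒q≉0 S e≈0 q≈0 = pq-not-both-zero S (e≈0∧q≈0⇒p≈0 S e≈0 q≈0) q≈0

  choose : ∀ S → Σ[ b ∈ ℂ ] b ∈ 𝒥 × Advance S b
  choose S with ≈0-or-≉0 (e₀ S)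
  ... | inj₂ e≉0 = digit , digit∈𝒥 ,
      inj₁ (e≉0 , ⊏-respʳ (error-step digit (p₀ S) (p₋ S) (q₀ S) (q₋ S)) advance)
    where open Approximation em (e₋ S) (q₀ S) (q₋ S) e≉0 (unimodular S)
  ... | inj₁ e≈0 =
    let b , b∈𝒥 , q< = enlarge (q₋ S) (e≈0⇒q≉0 S e≈0)
    -- The digit multiplies a vanishing error, so every digit restores the previous error and only
    -- the denominator has to grow.
    in b , b∈𝒥 , inj₂ (e≈0 , inj₂ (inj₂ (N-cong (e₁≈e₋ b)) , q<))
    where
    e₁≈e₋ : ∀ b → error (b * p₀ S + p₋ S) (b * q₀ S + q₋ S) ≈ e₋ S
    e₁≈e₋ b = ℂ-ring.trans (ℂ-ring.sym (error-step b (p₀ S) (p₋ S) (q₀ S) (q₋ S)))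
      (ℂ-ι.linear-combination b e≈0
        (solve 3 (λ b e e′ → b :* e :+ e′ :- e′ := b :* (e :- con (+ 0))) ℂ-ring.refl b (e₀ S) (e₋ S)))

  next : State → State
  next S = record
    { p₀ = b * p₀ S + p₋ S ; p₋ = p₀ S ; q₀ = b * q₀ S + q₋ S ; q₋ = q₀ S
    ; p₀∈𝔬 = 𝔬-+ (𝔬-* b∈𝔬 (p₀∈𝔬 S)) (p₋∈𝔬 S) ; p₋∈𝔬 = p₀∈𝔬 S
    ; q₀∈𝔬 = 𝔬-+ (𝔬-* b∈𝔬 (q₀∈𝔬 S)) (q₋∈𝔬 S) ; q₋∈𝔬 = q₀∈𝔬 S
    ; unimodular = ℝ.trans (N-cong
        (solve 6 (λ b p p′ q q′ z →
          q :* ((b :* q :+ q′) :* z :- (b :* p :+ p′)) :- (q :* z :- p) :* (b :* q :+ q′)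
          := :- (q′ :* (q :* z :- p) :- (q′ :* z :- p′) :* q))
          ℂ-ring.refl b (p₀ S) (p₋ S) (q₀ S) (q₋ S) z))
        (ℝ.trans (N-neg _) (unimodular S)) }
    where
    b    = proj₁ (choose S)
    b∈𝔬 = 𝒥⊆𝔬 (proj₁ (proj₂ (choose S)))

  initial : State
  initial = record
    { p₀ = 0# ; p₋ = 1# ; q₀ = 1# ; q₋ = 0#
    ; p₀∈𝔬 = 0∈𝔬 ; p₋∈𝔬 = 1∈𝔬 ; q₀∈𝔬 = 1∈𝔬 ; q₋∈𝔬 = 0∈𝔬
    ; unimodular = ℝ.trans (N-cong
        (solve 1 (λ z → con (+ 0) :* (con (+ 1) :* z :- con (+ 0)) :- (con (+ 0) :* z :- con (+ 1)) :* con (+ 1) := con (+ 1))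
          ℂ-ring.refl z)) N-1 }

  state : ℕ → State
  state zero    = initial
  state (suc n) = next (state n)

  digits : ℕ → ℂ
  digits zero    = 0#
  -- The digit chosen in state `n` has index `n + 1`, so that state `n` carries the terms of index
  -- `n`; index 0 gets a default.
  digits (suc n) = proj₁ (choose (state n))

  p≡ : ∀ n → p digits n ≡ p₀ (state n)
  p≡ zero          = ≡.refl
  p≡ (suc zero)    = ≡.refl
  p≡ (suc (suc n)) = ≡.cong₂ (λ x y → digits (suc (suc n)) * x + y) (p≡ (suc n)) (p≡ n)

  q≡ : ∀ n → q digits n ≡ q₀ (state n)
  q≡ zero          = ≡.refl
  q≡ (suc zero)    = ≡.refl
  q≡ (suc (suc n)) = ≡.cong₂ (λ x y → digits (suc (suc n)) * x + y) (q≡ (suc n)) (q≡ n)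

  ⊏⇒⊑ : ∀ {x y} → x ⊏ y → x ⊑ y
  ⊏⇒⊑ (inj₁ e<)        = inj₁ e<
  ⊏⇒⊑ (inj₂ (e≤ , q<)) = inj₂ (e≤ , inj₁ q<)

  ⊑-⊏-trans : ∀ {x y w} → x ⊑ y → y ⊏ w → x ⊏ w
  ⊑-⊏-trans (inj₁ a<)        (inj₁ b<)        = inj₁ (ℝ.<-trans b< a<)
  ⊑-⊏-trans (inj₁ a<)        (inj₂ (b≤ , _))  = inj₁ (ℝ.≤-<-trans b≤ a<)
  ⊑-⊏-trans (inj₂ (a≤ , _))  (inj₁ b<)        = inj₁ (ℝ.<-≤-trans b< a≤)
  ⊑-⊏-trans (inj₂ (a≤ , q≤)) (inj₂ (b≤ , q<)) = inj₂ (ℝ.≤-trans b≤ a≤ , ℝ.≤-<-trans q≤ q<)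

  -- If e₀ vanishes then e₋ does not, and e₋ is the error to compare with.
  Above : ℂ × ℂ → State → Set
  Above x S = (e₀ S ≉ 0# × x ⊏ (e₀ S , q₀ S)) ⊎ (e₀ S ≈ 0# × x ⊑ (e₋ S , q₋ S))

  -- If the new error vanishes, the current pair becomes the previous one, and the weak comparison
  -- with it is all that `Above` asks for; otherwise the step itself gives strictness.
  above-extend : ∀ {x} S → e₀ S ≉ 0# → x ⊑ (e₀ S , q₀ S) → Above x (next S)
  above-extend S e≉0 x⊑ with proj₂ (proj₂ (choose S)) | ≈0-or-≉0 (e₀ (next S))
  ... | inj₂ (e≈0 , _) | _         = ⊥-elim (e≉0 e≈0)
  ... | inj₁ (_ , adv) | inj₁ e₁≈0 = inj₂ (e₁≈0 , x⊑)
  ... | inj₁ (_ , adv) | inj₂ e₁≉0 = inj₁ (e₁≉0 , ⊑-⊏-trans x⊑ adv)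

  above-next : ∀ {x} S → Above x S → Above x (next S)
  above-next S (inj₁ (e≉0 , x⊏)) = above-extend S e≉0 (⊏⇒⊑ x⊏)
  above-next S (inj₂ (e≈0 , x⊑)) with proj₂ (proj₂ (choose S))
  ... | inj₁ (e≉0 , _) = ⊥-elim (e≉0 e≈0)
  ... | inj₂ (_ , adv) =
    -- Two consecutive errors cannot both vanish, so after a zero error the strict alternative
    -- applies again.
    inj₁ ((λ e₁≈0 → degenerate e₁≈0 e≈0 (unimodular (next S))) , ⊑-⊏-trans x⊑ adv)

  ⊑-refl : ∀ {x} → x ⊑ x
  ⊑-refl = inj₂ (inj₂ ℝ.refl , inj₂ ℝ.refl)

  above-later : ∀ {n m} → e₀ (state n) ≉ 0# → n ℕ.<′ m → Above (e₀ (state n) , q₀ (state n)) (state m)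
  above-later {n} e≉0 ℕ.≤′-refl             = above-extend (state n) e≉0 ⊑-refl
  above-later     e≉0 (ℕ.≤′-step {m} n<m) = above-next (state m) (above-later e≉0 n<m)

  N-e₋₁ : ∣ e₋ initial ∣² ≈ʳ 1ʳ
  N-e₋₁ = ℝ.trans (N-cong
    (solve 1 (λ z → con (+ 0) :* z :- con (+ 1) := :- con (+ 1)) ℂ-ring.refl z)) (ℝ.trans (N-neg 1#) N-1)

  N-e₀ : ∣ e₀ initial ∣² ≈ʳ ∣ z ∣²
  N-e₀ = N-cong (solve 1 (λ z → con (+ 1) :* z :- con (+ 0) := z) ℂ-ring.refl z)

  -- The chain starts at the formal index -1, with error -1 and denominator 0; the first comparison
  -- is where `∣ z ∣ ≤ 1` enters. It yields both `∣ e ∣ ≤ 1` and the nonvanishing of the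
  -- denominators.
  above-initial : ∀ n → Above (e₋ initial , 0#) (state n)
  above-initial (suc n) = above-next (state n) (above-initial n)
  above-initial zero with ≈0-or-≉0 (e₀ initial)
  ... | inj₁ e≈0 = inj₂ (e≈0 , ⊑-refl)
  ... | inj₂ e≉0 = inj₁ (e≉0 , inj₂ (ℝ.≤-trans (inj₂ N-e₀) (ℝ.≤-respʳ-≈ (ℝ.sym N-e₋₁) N-z≤1) ,
                                     ℝ.<-respˡ-≈ (ℝ.sym N-0) (ℝ.<-respʳ-≈ (ℝ.sym N-1) ℝ.0<1)))

  N-≈0 : ∀ {w} → w ≈ 0# → ∣ w ∣² ≈ʳ 0ʳ
  N-≈0 w≈0 = ℝ.trans (N-cong w≈0) N-0

  N-e≤1 : ∀ n → ∣ e₀ (state n) ∣² ≤ʳ 1ʳ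
  N-e≤1 n with above-initial n
  ... | inj₁ (_ , inj₁ e<)       = inj₁ (ℝ.<-respʳ-≈ N-e₋₁ e<)
  ... | inj₁ (_ , inj₂ (e≤ , _)) = ℝ.≤-respʳ-≈ N-e₋₁ e≤
  ... | inj₂ (e≈0 , _)           = ℝ.≤-trans (inj₂ (N-≈0 e≈0)) ℝ.0≤1

  -- If the denominator has not grown beyond 0 in the comparison with index -1, then `∣ e ∣ < 1`,
  -- whereas `q = 0` would give `e = - p` with `p` a nonzero Eisenstein integer, of norm at least 1.
  -- For a vanishing error the determinant decides.
  q≉0 : ∀ n → q₀ (state n) ≉ 0#
  q≉0 n with above-initial n
  ... | inj₂ (e≈0 , _) = e≈0⇒q≉0 (state n) e≈0
  ... | inj₁ (_ , inj₂ (_ , q<)) = 0<N⇒≉0 (ℝ.<-respˡ-≈ N-0 q<)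
  ... | inj₁ (_ , inj₁ e<) = λ q≈0 → ℝ.<⇒≱ (ℝ.<-respʳ-≈ N-e₋₁ e<)
    (ℝ.≤-respʳ-≈ (ℝ.trans (ℝ.sym (N-neg (p₀ S))) (N-cong (ℂ-ring.sym (e≈-p q≈0))))
      (1≤N (p₀∈𝔬 S) (λ p≈0 → pq-not-both-zero S p≈0 q≈0)))
    where
    S = state n
    e≈-p : q₀ S ≈ 0# → e₀ S ≈ - p₀ S
    e≈-p q≈0 = ℂ-ι.linear-combination z q≈0
      (solve 3 (λ p q z → q :* z :- p :- :- p := z :* (q :- con (+ 0))) ℂ-ring.refl (p₀ S) (q₀ S) z)

  -- Distinctness of the convergents and growth of the denominators

  Avoids : ℂ → ℂ → ℕ → Set
  Avoids a c n = e₀ (state n) ≈ 0# ⊎ ¬ (p₀ (state n) ≈ a × q₀ (state n) ≈ c)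

  ⊏-irrefl : ∀ {e f q r} → e ≈ f → q ≈ r → ¬ (e , q) ⊏ (f , r)
  ⊏-irrefl e≈f q≈r (inj₁ f<e)       = ℝ.irrefl (N-cong (ℂ-ring.sym e≈f)) f<e
  ⊏-irrefl e≈f q≈r (inj₂ (_ , q<r)) = ℝ.irrefl (N-cong q≈r) q<r

  -- The order is strict, so among the indices with nonzero error a pair occurs at most once.
  -- Excluded middle tells whether it occurs at all, and if so the bound is the next index.
  eventually-avoids : ∀ a c → Eventually (Avoids a c)
  eventually-avoids a c
    with em {∃[ n ] e₀ (state n) ≉ 0# × p₀ (state n) ≈ a × q₀ (state n) ≈ c}
  ... | no never = 0 , λ n _ → avoid n
    where
    avoid : ∀ n → Avoids a c n
    avoid n with ≈0-or-≉0 (e₀ (state n))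
    ... | inj₁ e≈0 = inj₁ e≈0
    ... | inj₂ e≉0 = inj₂ (λ (p≈a , q≈c) → never (n , e≉0 , p≈a , q≈c))
  ... | yes (n , e≉0 , p≈a , q≈c) = suc n , avoid
    where
    avoid : ∀ m → n ℕ.< m → Avoids a c m
    avoid m n<m with above-later e≉0 (Nat.<⇒<′ n<m)
    ... | inj₂ (e≈0 , _) = inj₁ e≈0
    ... | inj₁ (_ , x⊏)  = inj₂ (λ (p≈a′ , q≈c′) →
      let p≈p = ℂ-ring.trans p≈a (ℂ-ring.sym p≈a′)
          q≈q = ℂ-ring.trans q≈c (ℂ-ring.sym q≈c′)
      in ⊏-irrefl (error-cong p≈p q≈q) q≈q x⊏)

  AvoidsBox : ℕ → ℕ → Set
  AvoidsBox M n = ∀ i → ℤ.∣ i ∣ ℕ.< M → ∀ j → ℤ.∣ j ∣ ℕ.< M → ∀ k → ℤ.∣ k ∣ ℕ.< M → ∀ l → ℤ.∣ l ∣ ℕ.< M →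
    Avoids ⟨ ℝ.ι i , ℝ.ι j ⟩ ⟨ ℝ.ι k , ℝ.ι l ⟩ n

  eventually-avoids-box : ∀ M → Eventually (AvoidsBox M)
  eventually-avoids-box M =
    Eventually-bounded (λ i → Eventually-bounded (λ j → Eventually-bounded (λ k → Eventually-bounded
      (λ l → eventually-avoids ⟨ ℝ.ι i , ℝ.ι j ⟩ ⟨ ℝ.ι k , ℝ.ι l ⟩) M) M) M) M

  2ʳ : ℝ
  2ʳ = 1ʳ +ʳ 1ʳ

  -- Follows from `p = q z - e` with `∣ z ∣ ≤ 1` and `∣ e ∣ ≤ 1`.
  N-p-bound : ∀ n {K} → 0ʳ ≤ʳ K → ∣ q₀ (state n) ∣² ≤ʳ K → ∣ p₀ (state n) ∣² ≤ʳ 2ʳ *ʳ (K +ʳ 1ʳ)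
  N-p-bound n {K} 0≤K N-q≤K = ℝ.≤-trans (inj₂ (N-cong p≈qz-e))
    (ℝ.≤-trans (N-+≤ (q₀ S * z) (- e₀ S))
      (ℝ.*-monoʳ-≤ (inj₁ ℝ.0<2) (ℝ.+-mono-≤ N-qz≤K (ℝ.≤-trans (inj₂ (N-neg (e₀ S))) (N-e≤1 n)))))
    where
    S = state n
    p≈qz-e : p₀ S ≈ q₀ S * z + - e₀ S
    p≈qz-e = solve 3 (λ p q z → p := q :* z :+ :- (q :* z :- p)) ℂ-ring.refl (p₀ S) (q₀ S) z
    N-qz≤K : ∣ q₀ S * z ∣² ≤ʳ K
    N-qz≤K = ℝ.≤-trans (inj₂ (N-* (q₀ S) z)) (ℝ.≤-trans (ℝ.*-monoʳ-≤ (0≤N (q₀ S)) N-z≤1)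
      (ℝ.≤-trans (inj₂ (ℝ.*-identityʳ _)) N-q≤K))

  -- A state with nonzero error and `∣ q ∣² ≤ K` has both entries in a fixed finite box of lattice
  -- points, which the states with nonzero error eventually avoid.
  eventually-large : ∀ K → Eventually (λ n → e₀ (state n) ≈ 0# ⊎ K <ʳ ∣ q₀ (state n) ∣²)
  -- The factor 4 is that of `lattice-bound`; `2 (K + 1)` bounds `∣ p ∣²` and also exceeds `K`, so
  -- one box serves for both entries.
  eventually-large K with ℝ.archimedean em (4ʳ *ʳ (2ʳ *ʳ (K +ʳ 1ʳ)))
  ... | M , bound<M with eventually-avoids-box M
  ... | N , avoids = N , large
    where
    large : ∀ n → N ℕ.≤ n → e₀ (state n) ≈ 0# ⊎ K <ʳ ∣ q₀ (state n) ∣²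
    large n N≤n with ℝ.<-or-≥ K ∣ q₀ (state n) ∣²
    ... | inj₁ K<N-q = inj₂ K<N-q
    ... | inj₂ N-q≤K = conclude
      (lattice-bound (p₀∈𝔬 S) (ℝ.≤-<-trans (ℝ.*-monoʳ-≤ 0≤4 (N-p-bound n 0≤K N-q≤K)) bound<M))
      (lattice-bound (q₀∈𝔬 S) (ℝ.≤-<-trans (ℝ.*-monoʳ-≤ 0≤4 N-q≤) bound<M))
      where
      S = state n
      0≤K : 0ʳ ≤ʳ K
      0≤K = ℝ.≤-trans (0≤N (q₀ S)) N-q≤K
      0≤4 : 0ʳ ≤ʳ 4ʳ
      0≤4 = inj₁ 0<3 ℝ.0≤+ ℝ.0≤1
      N-q≤ : ∣ q₀ S ∣² ≤ʳ 2ʳ *ʳ (K +ʳ 1ʳ)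
      N-q≤ = ℝ.≤-trans N-q≤K (ℝ.0≤⇒≤ (0≤K ℝ.0≤+ inj₁ ℝ.0<2)
        (ℝ.solve 1 (λ K → ℝ.con (+ 2) ℝ.:* (K ℝ.:+ ℝ.con (+ 1)) ℝ.:= K ℝ.:+ (K ℝ.:+ ℝ.con (+ 2))) ℝ.refl K))
      conclude : ∃[ i ] ∃[ j ] ℤ.∣ i ∣ ℕ.< M × ℤ.∣ j ∣ ℕ.< M × p₀ S ≈ ⟨ ℝ.ι i , ℝ.ι j ⟩ →
                 ∃[ k ] ∃[ l ] ℤ.∣ k ∣ ℕ.< M × ℤ.∣ l ∣ ℕ.< M × q₀ S ≈ ⟨ ℝ.ι k , ℝ.ι l ⟩ →
                 e₀ S ≈ 0# ⊎ K <ʳ ∣ q₀ S ∣²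
      conclude (i , j , i< , j< , p≈ij) (k , l , k< , l< , q≈kl)
        with avoids n N≤n i i< j j< k k< l l<
      ... | inj₁ e≈0  = inj₁ e≈0
      ... | inj₂ avoid = ⊥-elim (avoid (p≈ij , q≈kl))

  N-quotient : ∀ p q → q ≉ 0# → ∣ q ∣² *ʳ ∣ p / q - z ∣² ≈ʳ ∣ error p q ∣²
  N-quotient p q q≉0 = ℝ.trans (ℝ.sym (N-* q (p / q - z))) (ℝ.trans (N-cong eq) (N-neg (error p q)))
    where
    eq : q * (p / q - z) ≈ - error p q
    eq = ℂ-ι.linear-combination p (⁻¹-inverseʳ q≉0)
      (solve 4 (λ p q i z → q :* (p :* i :- z) :- :- (q :* z :- p) := p :* (q :* i :- con (+ 1)))
        ℂ-ring.refl p q (q ⁻¹) z)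

  converges : (λ n → p digits n / q digits n) ⟶ z
  converges ε 0<ε = N , λ n N≤n → ≡.subst₂ (λ p q → Within ε (p / q) z) (≡.sym (p≡ n)) (≡.sym (q≡ n))
    (close n (large n N≤n))
    where
    0<ε² : 0ʳ <ʳ ε *ʳ ε
    0<ε² = ℝ.*-pos 0<ε 0<ε
    -- Beyond this bound `∣ e ∣² ≤ 1 < ε² ∣ q ∣²`, which is the required estimate multiplied by
    -- `∣ q ∣²`.
    K : ℝ
    K = (ε *ʳ ε) ⁻¹ʳ
    N     = proj₁ (eventually-large K)
    large = proj₂ (eventually-large K)
    close : ∀ n → e₀ (state n) ≈ 0# ⊎ K <ʳ ∣ q₀ (state n) ∣² → Within ε (p₀ (state n) / q₀ (state n)) z
    close n cases = ℝ.*-cancelˡ-< (0≤N (q₀ S))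
      (ℝ.<-respˡ-≈ (ℝ.sym (N-quotient (p₀ S) (q₀ S) (q≉0 n))) (N-e< cases))
      where
      S = state n
      N-e< : e₀ S ≈ 0# ⊎ K <ʳ ∣ q₀ S ∣² → ∣ e₀ S ∣² <ʳ ∣ q₀ S ∣² *ʳ (ε *ʳ ε)
      N-e< (inj₁ e≈0) = ℝ.<-respˡ-≈ (ℝ.sym (N-≈0 e≈0)) (ℝ.*-pos (0<N (q≉0 n)) 0<ε²)
      N-e< (inj₂ K<)  = ℝ.≤-<-trans (N-e≤1 n) (ℝ.<-respˡ-≈ (ℝ.⁻¹-inverseʳ (ℝ.0<⇒≉0 0<ε²))
        (ℝ.<-respʳ-≈ (ℝ.*-comm (ε *ʳ ε) ∣ q₀ S ∣²) (ℝ.*-monoʳ-< 0<ε² K<)))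

-- The domain U lies in the closed unit disc

module UnitDisc
  (R : CompleteOrderedField) (√3 : CompleteOrderedField.Carrier R) (isSqrt3 : IsSqrt3 R √3) where

  open Complex R

  open EisensteinProperties R √3 isSqrt3
  open Lattice R √3 isSqrt3

  open ℝ using (solve; con; _:+_; _:*_; _:-_; :-_; _:=_)

  -- Expansion of `∣ v - w ∣² ≥ 0`. For fixed `w` the left side is linear in `v`, so the bound
  -- passes to convex combinations; with `w` the combination itself it says that its norm is at most
  -- 1.
  2*inner≤ : ∀ {v} w → ∣ v ∣² ≤ʳ 1ʳ → (1ʳ +ʳ 1ʳ) *ʳ inner v w ≤ʳ 1ʳ +ʳ ∣ w ∣²
  2*inner≤ {v} w N-v≤1 = ℝ.0≤⇒≤ (ℝ.≤⇒0≤ N-v≤1 ℝ.0≤+ 0≤N (v - w)) (lemma v w)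
    where
    lemma : ∀ v w → 1ʳ +ʳ ∣ w ∣² ≈ʳ (1ʳ +ʳ 1ʳ) *ʳ inner v w +ʳ (1ʳ +ʳ -ʳ ∣ v ∣² +ʳ ∣ v - w ∣²)
    lemma (a +i b) (c +i d) = solve 4 (λ a b c d → con (+ 1) :+ (c :* c :+ d :* d)
      := con (+ 2) :* (a :* c :+ b :* d) :+ (con (+ 1) :- (a :* a :+ b :* b)
         :+ ((a :- c) :* (a :- c) :+ (b :- d) :* (b :- d)))) ℝ.refl a b c d

  2*inner-scale≤ : ∀ {t v} w → 0ʳ ≤ʳ t → ∣ v ∣² ≤ʳ 1ʳ →
    (1ʳ +ʳ 1ʳ) *ʳ inner (fromℝ t * v) w ≤ʳ t *ʳ (1ʳ +ʳ ∣ w ∣²)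
  2*inner-scale≤ {t} {v} w 0≤t N-v≤1 = ℝ.≤-trans (inj₂ (lemma v w)) (ℝ.*-monoʳ-≤ 0≤t (2*inner≤ w N-v≤1))
    where
    lemma : ∀ v w → (1ʳ +ʳ 1ʳ) *ʳ inner (fromℝ t * v) w ≈ʳ t *ʳ ((1ʳ +ʳ 1ʳ) *ʳ inner v w)
    lemma (a +i b) (c +i d) = solve 5 (λ t a b c d →
      con (+ 2) :* ((t :* a :- con (+ 0) :* b) :* c :+ (t :* b :+ con (+ 0) :* a) :* d)
      := t :* (con (+ 2) :* (a :* c :+ b :* d))) ℝ.refl t a b c d

  2*inner-+ : ∀ v s w → (1ʳ +ʳ 1ʳ) *ʳ inner (v + s) w ≈ʳ (1ʳ +ʳ 1ʳ) *ʳ inner v w +ʳ (1ʳ +ʳ 1ʳ) *ʳ inner s w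
  2*inner-+ (a +i b) (e +i f) (c +i d) = solve 6 (λ a b c d e f →
    con (+ 2) :* ((a :+ e) :* c :+ (b :+ f) :* d)
    := con (+ 2) :* (a :* c :+ b :* d) :+ con (+ 2) :* (e :* c :+ f :* d)) ℝ.refl a b c d e f

  -- The weights have arbitrary sum here, so that the induction can split off one point without
  -- rescaling the others.
  2*inner-combination≤ : ∀ {k} (t : Fin k → ℝ) (v : Fin k → ℂ) w →
    (∀ i → 0ʳ ≤ʳ t i) → (∀ i → ∣ v i ∣² ≤ʳ 1ʳ) →
    (1ʳ +ʳ 1ʳ) *ʳ inner (sumᶜ (λ i → fromℝ (t i) * v i)) w ≤ʳ sumʳ t *ʳ (1ʳ +ʳ ∣ w ∣²)
  2*inner-combination≤ {zero} t v (c +i d) 0≤t N-v≤1 = inj₂ (solve 2 (λ c d →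
    con (+ 2) :* (con (+ 0) :* c :+ con (+ 0) :* d) := con (+ 0) :* (con (+ 1) :+ (c :* c :+ d :* d))) ℝ.refl c d)
  2*inner-combination≤ {suc k} t v w 0≤t N-v≤1 = ℝ.≤-trans
    (inj₂ (2*inner-+ (fromℝ (t zero) * v zero) (sumᶜ (λ i → fromℝ (t (suc i)) * v (suc i))) w))
    (ℝ.≤-respʳ-≈ (ℝ.sym (ℝ.distribʳ _ _ _)) (ℝ.+-mono-≤ (2*inner-scale≤ w (0≤t zero) (N-v≤1 zero))
      (2*inner-combination≤ (λ i → t (suc i)) (λ i → v (suc i)) w (λ i → 0≤t (suc i)) (λ i → N-v≤1 (suc i)))))

  2*inner-self≤⇒N≤1 : ∀ z → (1ʳ +ʳ 1ʳ) *ʳ inner z z ≤ʳ 1ʳ +ʳ ∣ z ∣² → ∣ z ∣² ≤ʳ 1ʳ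
  2*inner-self≤⇒N≤1 z 2N≤1+N = ℝ.0≤⇒≤ (ℝ.≤⇒0≤ 2N≤1+N)
    (solve 1 (λ n → con (+ 1) := n :+ (con (+ 1) :+ n :- con (+ 2) :* n)) ℝ.refl ∣ z ∣²)

  convexHull≤1 : ∀ {k} (v : Fin k → ℂ) → (∀ i → ∣ v i ∣² ≤ʳ 1ʳ) → ∀ {z} → z ∈ ConvexHull v → ∣ z ∣² ≤ʳ 1ʳ
  convexHull≤1 v N-v≤1 {z} (t , 0≤t , Σt≈1 , z≈) = 2*inner-self≤⇒N≤1 z
    (ℝ.≤-trans (inj₂ (ℝ.*-congˡ (inner-congˡ z z≈))) (ℝ.≤-respʳ-≈ (ℝ.trans (ℝ.*-congʳ Σt≈1) (ℝ.*-identityˡ _))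
      (2*inner-combination≤ t v z 0≤t N-v≤1)))

  openSegment≤1 : ∀ {a b z} → ∣ a ∣² ≤ʳ 1ʳ → ∣ b ∣² ≤ʳ 1ʳ → z ∈ OpenSegment a b → ∣ z ∣² ≤ʳ 1ʳ
  openSegment≤1 {a} {b} {z} N-a≤1 N-b≤1 (t , 0<t , t<1 , z≈) = 2*inner-self≤⇒N≤1 z
    (ℝ.≤-trans (inj₂ (ℝ.trans (ℝ.*-congˡ (inner-congˡ z z≈′)) (2*inner-+ (fromℝ t * a) (fromℝ (1ʳ +ʳ -ʳ t) * b) z)))
      (ℝ.≤-respʳ-≈ (solve 2 (λ t n → t :* n :+ (con (+ 1) :- t) :* n := n) ℝ.refl t (1ʳ +ʳ ∣ z ∣²))
        (ℝ.+-mono-≤ (2*inner-scale≤ z (inj₁ 0<t) N-a≤1) (2*inner-scale≤ z (inj₁ (ℝ.<⇒0< t<1)) N-b≤1))))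
    where
    z≈′ : z ≈ fromℝ t * a + fromℝ (1ʳ +ʳ -ʳ t) * b
    z≈′ = ℂ-ring.trans z≈ (ℂ-ring.+-congˡ {fromℝ t * a} (ℂ-ring.*-congʳ {b} (ℂ-ring.sym
      (ℂ-ring.trans (fromℝ-+ 1ʳ (-ʳ t)) (ℂ-ring.+-congˡ {1#} (fromℝ-neg t))))))

  N-ζ : ∣ ζ ∣² ≈ʳ 1ʳ
  N-ζ = ℝ.trans (N-cong (ℂ-ι.solve 1 (λ ζ → ζ ℂ-ι.:= ℂ-ι.con (+ 0) ℂ-ι.:+ ℂ-ι.con (+ 1) ℂ-ι.:* ζ) ℂ-ring.refl ζ))
    (ℝ.trans (N-⟨,⟩ 0ʳ 1ʳ) (solve 0 (con (+ 0) :* con (+ 0) :+ con (+ 0) :* con (+ 1) :+ con (+ 1) :* con (+ 1) := con (+ 1)) ℝ.refl))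

  N-ζ^ : ∀ n → ∣ ζ ^ n ∣² ≈ʳ 1ʳ
  N-ζ^ zero    = N-1
  N-ζ^ (suc n) = ℝ.trans (N-* ζ (ζ ^ n)) (ℝ.trans (ℝ.*-cong N-ζ (N-ζ^ n)) (ℝ.*-identityʳ 1ʳ))

  N-conj : ∀ z → ∣ conj z ∣² ≈ʳ ∣ z ∣²
  N-conj (a +i b) = solve 2 (λ a b → a :* a :+ :- b :* :- b := a :* a :+ b :* b) ℝ.refl a b

  N-conj-ζ : ∣ conj ζ ∣² ≈ʳ 1ʳ
  N-conj-ζ = ℝ.trans (N-conj ζ) N-ζ

  within-self : ∀ {ε} z → 0ʳ <ʳ ε → Within ε z z
  within-self z 0<ε = ℝ.<-respˡ-≈ (ℝ.sym (ℝ.trans (N-cong (ℂ-ring.-‿inverseʳ z)) N-0)) (ℝ.*-pos 0<ε 0<ε)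

  U≤1 : ∀ {z} → z ∈ U → ∣ z ∣² ≤ʳ 1ʳ
  U≤1 {z} (interior (ε , 0<ε , ball)) =
    convexHull≤1 (λ k → ζ ^ toℕ k) (λ k → inj₂ (N-ζ^ (toℕ k))) (ball z (within-self z 0<ε))
  U≤1 (side₁ z∈) = openSegment≤1 (inj₂ N-ζ) (inj₂ (ℝ.trans (N-neg (conj ζ)) N-conj-ζ)) z∈
  U≤1 (side₂ z∈) = openSegment≤1 (inj₂ (ℝ.trans (N-neg ζ) N-ζ)) (inj₂ (ℝ.trans (N-neg 1#) N-1)) z∈
  U≤1 (side₃ z∈) = openSegment≤1 (inj₂ N-1) (inj₂ N-conj-ζ) z∈
  U≤1 (vertex₁ z≈) = inj₂ (ℝ.trans (N-cong z≈) (ℝ.trans (N-neg ζ) N-ζ))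
  U≤1 (vertex₂ z≈) = inj₂ (ℝ.trans (N-cong z≈) N-conj-ζ)

open import Data.Nat.Base using (_≤_)

theorem1 : ExcludedMiddle 0ℓ →
    (R : CompleteOrderedField) →
    let open Complex R in
    (√3 : ℝ) → 0ʳ <ʳ √3 → √3 *ʳ √3 ≈ʳ 1ʳ +ʳ 1ʳ +ʳ 1ʳ →
    let open Eisenstein √3 in
    (z : ℂ) → z ∈ U →
    Σ[ b ∈ (ℕ → ℂ) ]
    (∀ n → 1 ≤ n → b n ∈ 𝒥) ×
    (∀ n → q b n ≉ 0#) ×
    (λ n → p b n / q b n) ⟶ z
theorem1 em R √3 0<√3 √3² z z∈U = digits , digits∈𝒥 , q-digits≉0 , converges
  where
  open Complex R
  open Eisenstein √3
  open UnitDisc R √3 (0<√3 , √3²)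
  open Expansion em R √3 (0<√3 , √3²) z (U≤1 z∈U)

  digits∈𝒥 : ∀ n → 1 ≤ n → digits n ∈ 𝒥
  digits∈𝒥 (suc n) _ = proj₁ (proj₂ (choose (state n)))

  q-digits≉0 : ∀ n → q digits n ≉ 0#
  q-digits≉0 n = ≡.subst (_≉ 0#) (≡.sym (q≡ n)) (q≉0 n)
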